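{- Let $K$ be a global field of characteristic different from $2$, let $\mathfrak{p}$ be a finite non-dyadic place of $K$, and let $a\in K$ be nonzero. Then the length $\ell_{\mathfrak p}(a)$ of $a$ in the completion $K_{\mathfrak p}$ is given by the following procedure (that is, the procedure correctly returns $\ell_{\mathfrak p}(a)$): \begin{itemize} \item if $v_{\mathfrak p}(a)$ is odd and $-1$ is a square in $K_{\mathfrak p}$, then $\ell_{\mathfrak p}(a)=2$; \item if $v_{\mathfrak p}(a)$ is odd and $-1$ is not a square in $K_{\mathfrak p}$, then $\ell_{\mathfrak p}(a)=3$; \item if $v_{\mathfrak p}(a)$ is even and $a$ is a square in $K_{\mathfrak p}$, then $\ell_{\mathfrak p}(a)=1$; \item if $v_{\mathfrak p}(a)$ is even and $a$ is not a square in $K_{\mathfrak p}$, then $\ell_{\mathfrak p}(a)=2$. \end{itemize}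
   Context: A global field of characteristic different from $2$ is either a number field (finite extension of $\mathbb{Q}$) or a finite extension of $\mathbb{F}(X)$ with $\mathbb{F}$ a finite field of characteristic not $2$ (a global function field). A finite place $\mathfrak p$ is dyadic if it divides $2$ and non-dyadic otherwise; in a global function field of characteristic $\neq 2$ every place is regarded as a finite non-dyadic place. $K_{\mathfrak p}$ is the completion of $K$ at $\mathfrak p$, and $v_{\mathfrak p}$ is the normalized $\mathfrak p$-adic valuation (value group $\mathbb{Z}$). The length $\ell_{\mathfrak p}(a)$ of a nonzero element $a$ in $K_{\mathfrak p}$ is the minimal number of summands needed to write $a$ as a sum of squares of elements of $K_{\mathfrak p}$, and is $\infty$ if $a$ is not such a sum. -}

module Defs where

open import Level using (Level; 0ℓ; suc; _⊔_)
open import Algebra.Apartness.Bundles using (HeytingField; module HeytingCommutativeRing)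
open import Algebra.Bundles using (CommutativeRing)
open import Algebra.Morphism.Structures using (IsRingHomomorphism)
import Algebra.Definitions.RawMonoid as RawMonoidDefinitions
import Algebra.Properties.Ring as RingProperties
import Algebra.Properties.AbelianGroup as AbelianGroupProperties
import Algebra.Properties.CommutativeSemigroup as SemigroupProperties
import Algebra.Apartness.Properties.HeytingCommutativeRing as HeytingRingProperties
open import Data.Fin.Base using (Fin)
open import Data.Integer.Base as ℤ using (ℤ; +_; 0ℤ; 1ℤ)
import Data.Integer.Properties as ℤ
import Data.Integer.Divisibility as ℤ
open import Data.List.Base using (List; foldr)
open import Data.List.Relation.Unary.Any using (Any)
open import Data.Nat.Base as ℕ using (ℕ)
import Data.Nat.Properties as ℕ
open import Data.Product.Base using (Σ-syntax; ∃-syntax; _×_; _,_; proj₁; proj₂)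
open import Data.Rational.Properties using () renaming (heytingField to ℚ-field)
open import Data.Unit.Polymorphic.Base using (⊤)
open import Data.Vec.Functional using (Vector)
open import Function.Bundles using (Inverse; _⇔_; module Equivalence)
open import Relation.Binary.Construct.Add.Supremum.NonStrict ℤ._≤_ using (_≤⁺_; [_]; _≤⊤⁺; ≤⁺-trans)
open import Relation.Binary.PropositionalEquality as ≡ using (_≡_)
open import Relation.Nullary.Construct.Add.Supremum using (_⁺; [_]; ⊤⁺)
open import Relation.Nullary.Negation.Core using (¬_; contradiction)
open import Relation.Binary.Definitions using (tri<; tri≈; tri>)
open import Relation.Binary.Structures using (IsEquivalence)

private
  variable
    c c′ ℓ₁ ℓ₁′ ℓ₂ ℓ₂′ : Level

module SumsOfSquares {c ℓ} (R : CommutativeRing c ℓ) where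
  open CommutativeRing R
  open RawMonoidDefinitions +-rawMonoid using (sum)

  IsSquare : Carrier → Set (c ⊔ ℓ)
  IsSquare a = ∃[ x ] a ≈ x * x

  IsSumOfSquares : ℕ → Carrier → Set (c ⊔ ℓ)
  IsSumOfSquares n a = Σ[ x ∈ Vector Carrier n ] a ≈ sum (λ i → x i * x i)

  -- HasLength a l says that ℓ(a) = l, where l ∈ ℕ ∪ {∞}.
  HasLength : Carrier → ℕ ⁺ → Set (c ⊔ ℓ)
  HasLength a [ n ] = IsSumOfSquares n a × (∀ m → m ℕ.< n → ¬ IsSumOfSquares m a)
  HasLength a ⊤⁺    = ∀ n → ¬ IsSumOfSquares n a

-- A field is a HeytingField of the standard library; "x is nonzero" is
-- x # 0#, which is equivalent to x being invertible.

commutativeRing : HeytingField c ℓ₁ ℓ₂ → CommutativeRing c ℓ₁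
commutativeRing K = HeytingCommutativeRing.commutativeRing (HeytingField.heytingCommutativeRing K)

record Extension (k : HeytingField c ℓ₁ ℓ₂) (K : HeytingField c′ ℓ₁′ ℓ₂′)
       : Set (c ⊔ ℓ₁ ⊔ c′ ⊔ ℓ₁′) where
  private
    module k = HeytingField k
    module K = HeytingField K
  field
    ⟦_⟧   : k.Carrier → K.Carrier
    isHom : IsRingHomomorphism (CommutativeRing.rawRing (commutativeRing k))
                               (CommutativeRing.rawRing (commutativeRing K)) ⟦_⟧

-- An extension K/k is finite when K is finitely generated as a k-vector space.
record FiniteExtension (k : HeytingField c ℓ₁ ℓ₂) (K : HeytingField c′ ℓ₁′ ℓ₂′)
       : Set (c ⊔ ℓ₁ ⊔ c′ ⊔ ℓ₁′) where
  private
    module k = HeytingField k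
    module K = HeytingField K
  open RawMonoidDefinitions (CommutativeRing.+-rawMonoid (commutativeRing K)) using (sum)
  field
    extension : Extension k K
  open Extension extension public
  field
    size       : ℕ
    generators : Vector K.Carrier size
    spanning   : ∀ x → Σ[ a ∈ Vector k.Carrier size ] x K.≈ sum (λ i → ⟦ a i ⟧ K.* generators i)

Char≢2 : HeytingField c ℓ₁ ℓ₂ → Set ℓ₁
Char≢2 K = ¬ (1# + 1# ≈ 0#)
  where open HeytingField K

IsFinite : HeytingField c ℓ₁ ℓ₂ → Set (c ⊔ ℓ₁)
IsFinite F = ∃[ n ] Inverse (CommutativeRing.setoid (commutativeRing F)) (≡.setoid (Fin n))

-- E is the field F(X) of rational functions over F: X is transcendental over F
-- (a polynomial with a nonzero coefficient has a nonzero value at X, so that F[X]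
-- embeds in E), and every element of E is a fraction p(X) / q(X).
-- The list a₀ ∷ a₁ ∷ … represents the polynomial a₀ + a₁ X + ….
record IsRationalFunctionField (F : HeytingField c ℓ₁ ℓ₂) (E : HeytingField c′ ℓ₁′ ℓ₂′)
       : Set (c ⊔ ℓ₁ ⊔ ℓ₂ ⊔ c′ ⊔ ℓ₁′ ⊔ ℓ₂′) where
  private
    module F = HeytingField F
    module E = HeytingField E
  field
    extension : Extension F E
    X         : E.Carrier
  open Extension extension public

  ⟨_⟩ : List F.Carrier → E.Carrier
  ⟨ p ⟩ = foldr (λ a r → ⟦ a ⟧ E.+ X E.* r) E.0# p

  field
    transcendental : ∀ p → Any (F._# F.0#) p → ⟨ p ⟩ E.# E.0#
    fraction       : ∀ e → ∃[ p ] ∃[ q ] ⟨ q ⟩ E.# E.0# × e E.* ⟨ q ⟩ E.≈ ⟨ p ⟩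

data IsGlobalField≢2 (K : HeytingField c ℓ₁ ℓ₂) : Set (suc (c ⊔ ℓ₁ ⊔ ℓ₂)) where
  numberField   : FiniteExtension ℚ-field K → IsGlobalField≢2 K
  functionField : (F E : HeytingField c ℓ₁ ℓ₂) →
                  IsFinite F → Char≢2 F →
                  IsRationalFunctionField F E →
                  FiniteExtension E K →
                  IsGlobalField≢2 K

-- ℤ ⁺ is ℤ ∪ {∞}, with ∞ written ⊤⁺.

infixl 6 _+⁺_
infixl 7 _⊓⁺_

_+⁺_ : ℤ ⁺ → ℤ ⁺ → ℤ ⁺
[ m ] +⁺ [ n ] = [ m ℤ.+ n ]
[ m ] +⁺ ⊤⁺    = ⊤⁺
⊤⁺    +⁺ _     = ⊤⁺

_⊓⁺_ : ℤ ⁺ → ℤ ⁺ → ℤ ⁺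
[ m ] ⊓⁺ [ n ] = [ m ℤ.⊓ n ]
[ m ] ⊓⁺ ⊤⁺    = [ m ]
⊤⁺    ⊓⁺ n     = n

Even Odd : ℤ → Set
Even n = + 2 ℤ.∣ n
Odd n  = ¬ Even n

B+[N-B]≡N : ∀ B N → B ℤ.+ (N ℤ.- B) ≡ N
B+[N-B]≡N B N = ≡.trans (ℤ.+-comm B (N ℤ.- B))
  (≡.trans (ℤ.+-assoc N (ℤ.- B) B) (≡.trans (≡.cong (λ k → N ℤ.+ k) (ℤ.+-inverseˡ B)) (ℤ.+-identityʳ N)))

-- A finite place of a global field (any place, for a function field) is given
-- by its normalized valuation.  nonzero⇔finite is the positive form of
-- "v x = ∞ if and only if x = 0"; surjective says that the value group is ℤ.
record FinitePlace (K : HeytingField c ℓ₁ ℓ₂) : Set (c ⊔ ℓ₁ ⊔ ℓ₂) where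
  open HeytingField K
  field
    v              : Carrier → ℤ ⁺
    v-cong         : ∀ {x y} → x ≈ y → v x ≡ v y
    nonzero⇔finite : ∀ {x} → x # 0# ⇔ (∃[ n ] v x ≡ [ n ])
    v-*            : ∀ x y → v (x * y) ≡ v x +⁺ v y
    v-+            : ∀ x y → v x ⊓⁺ v y ≤⁺ v (x + y)
    surjective     : ∀ n → ∃[ x ] v x ≡ [ n ]

  Dyadic : Set
  Dyadic = [ 1ℤ ] ≤⁺ v (1# + 1#)

-- Every place of a function field counts as finite and non-dyadic.
NonDyadic : {K : HeytingField c ℓ₁ ℓ₂} → IsGlobalField≢2 K → FinitePlace K → Set
NonDyadic (numberField _)             𝔭 = ¬ FinitePlace.Dyadic 𝔭
NonDyadic (functionField _ _ _ _ _ _) 𝔭 = ⊤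

-- The completion is the ring of Cauchy sequences modulo null sequences.

module Completion (K : HeytingField c ℓ₁ ℓ₂) (𝔭 : FinitePlace K) where
  open HeytingField K
  open FinitePlace 𝔭
  private module R = CommutativeRing (commutativeRing K)
  open HeytingRingProperties heytingCommutativeRing using (1#0)
  open RingProperties R.ring
    using (-1*x≈-x; -‿involutive; -0#≈0#; [y-z]x≈yx-zx; x[y-z]≈xy-xz)
  open AbelianGroupProperties R.+-abelianGroup using (⁻¹-∙-comm; ⁻¹-anti-homo‿-)
  open SemigroupProperties R.+-commutativeSemigroup using (interchange)

  IsNull : (ℕ → Carrier) → Set
  IsNull s = ∀ (N : ℤ) → ∃[ M ] ∀ n → M ℕ.≤ n → [ N ] ≤⁺ v (s n)

  IsCauchy : (ℕ → Carrier) → Set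
  IsCauchy s = ∀ (N : ℤ) → ∃[ M ] ∀ m n → M ℕ.≤ m → M ℕ.≤ n → [ N ] ≤⁺ v (s m - s n)

  record CauchySequence : Set c where
    constructor mk
    field
      at       : ℕ → Carrier
      isCauchy : IsCauchy at
  open CauchySequence public

  bound-cong : ∀ {N x y} → x ≈ y → [ N ] ≤⁺ v x → [ N ] ≤⁺ v y
  bound-cong {N} x≈y = ≡.subst ([ N ] ≤⁺_) (v-cong x≈y)

  bound-+ : ∀ {N x y} → [ N ] ≤⁺ v x → [ N ] ≤⁺ v y → [ N ] ≤⁺ v (x + y)
  bound-+ p q = ≤⁺-trans ℤ.≤-trans (⊓-glb p q) (v-+ _ _)
    where
    ⊓-glb : ∀ {N a b} → [ N ] ≤⁺ a → [ N ] ≤⁺ b → [ N ] ≤⁺ (a ⊓⁺ b)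
    ⊓-glb {a = [ _ ]} {[ _ ]} [ p ] [ q ] = [ ℤ.⊓-glb p q ]
    ⊓-glb {a = [ _ ]} {⊤⁺}    p     q     = p
    ⊓-glb {a = ⊤⁺}            p     q     = q

  bound-* : ∀ {M N x y} → [ M ] ≤⁺ v x → [ N ] ≤⁺ v y → [ M ℤ.+ N ] ≤⁺ v (x * y)
  bound-* {x = x} {y} p q = ≡.subst (_ ≤⁺_) (≡.sym (v-* x y)) (+-mono p q)
    where
    +-mono : ∀ {M N a b} → [ M ] ≤⁺ a → [ N ] ≤⁺ b → [ M ℤ.+ N ] ≤⁺ (a +⁺ b)
    +-mono {a = [ _ ]} {[ _ ]} [ p ] [ q ] = [ ℤ.+-mono-≤ p q ]
    +-mono {a = [ _ ]} {⊤⁺}    p     q     = _ ≤⊤⁺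
    +-mono {a = ⊤⁺}            p     q     = _ ≤⊤⁺

  bound-≤ : ∀ {M N x} → M ℤ.≤ N → [ N ] ≤⁺ v x → [ M ] ≤⁺ v x
  bound-≤ M≤N = ≤⁺-trans ℤ.≤-trans [ M≤N ]

  []-inj : ∀ {m n : ℤ} → _≡_ {A = ℤ ⁺} [ m ] [ n ] → m ≡ n
  []-inj ≡.refl = ≡.refl

  v-1 : v 1# ≡ [ 0ℤ ]
  v-1 with Equivalence.to nonzero⇔finite 1#0
  ... | n , v1≡n = ≡.trans v1≡n (≡.cong [_] n≡0)
    where
    n+n≡n : n ℤ.+ n ≡ n
    n+n≡n = []-inj (≡.trans (≡.sym (≡.cong₂ _+⁺_ v1≡n v1≡n))
                    (≡.trans (≡.sym (v-* 1# 1#))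
                    (≡.trans (v-cong (R.*-identityʳ 1#)) v1≡n)))
    n≡0 : n ≡ 0ℤ
    n≡0 = RingProperties.x+x≈x⇒x≈0 ℤ.+-*-ring n n+n≡n

  v--1 : v (- 1#) ≡ [ 0ℤ ]
  v--1 = root (v (- 1#)) (≡.trans (≡.sym (v-* (- 1#) (- 1#))) (≡.trans (v-cong -1*-1≈1) v-1))
    where
    -1*-1≈1 : - 1# * - 1# ≈ 1#
    -1*-1≈1 = R.trans (-1*x≈-x (- 1#)) (-‿involutive 1#)
    root : ∀ a → a +⁺ a ≡ [ 0ℤ ] → a ≡ [ 0ℤ ]
    root [ n ] eq with ℤ.<-cmp n 0ℤ
    ... | tri< n<0 _ _ = contradiction ([]-inj eq) (ℤ.<⇒≢ (ℤ.+-mono-< n<0 n<0))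
    ... | tri≈ _ n≡0 _ = ≡.cong [_] n≡0
    ... | tri> _ _ 0<n = contradiction (≡.sym ([]-inj eq)) (ℤ.<⇒≢ (ℤ.+-mono-< 0<n 0<n))

  bound-neg : ∀ {N x} → [ N ] ≤⁺ v x → [ N ] ≤⁺ v (- x)
  bound-neg {N} {x} p = ≡.subst (λ k → [ k ] ≤⁺ v (- x)) (ℤ.+-identityˡ N)
    (bound-cong (-1*x≈-x x) (bound-* (≡.subst ([ 0ℤ ] ≤⁺_) (≡.sym v--1) [ ℤ.≤-refl ]) p))

  bound-0 : ∀ {N x} → x ≈ 0# → [ N ] ≤⁺ v x
  bound-0 {N} {x} x≈0 with v x in eq
  ... | ⊤⁺    = _ ≤⊤⁺
  ... | [ n ] = contradiction (Equivalence.from nonzero⇔finite (n , eq)) (#-irrefl x≈0)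

  null-cong : ∀ {s t} → (∀ n → s n ≈ t n) → IsNull s → IsNull t
  null-cong s≈t p N = let M , b = p N in M , λ n M≤n → bound-cong (s≈t n) (b n M≤n)

  null-0 : ∀ {s} → (∀ n → s n ≈ 0#) → IsNull s
  null-0 s≈0 N = 0 , λ n _ → bound-0 (s≈0 n)

  null-+ : ∀ {s t} → IsNull s → IsNull t → IsNull (λ n → s n + t n)
  null-+ p q N =
    let M₁ , b₁ = p N
        M₂ , b₂ = q N
    in M₁ ℕ.⊔ M₂ , λ n M≤n →
         bound-+ (b₁ n (ℕ.m⊔n≤o⇒m≤o M₁ M₂ M≤n)) (b₂ n (ℕ.m⊔n≤o⇒n≤o M₁ M₂ M≤n))

  null-neg : ∀ {s} → IsNull s → IsNull (λ n → - s n)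
  null-neg p N = let M , b = p N in M , λ n M≤n → bound-neg (b n M≤n)

  EventuallyBounded : (ℕ → Carrier) → Set
  EventuallyBounded s = ∃[ B ] ∃[ M ] ∀ n → M ℕ.≤ n → [ B ] ≤⁺ v (s n)

  null-* : ∀ {s t} → EventuallyBounded s → IsNull t → IsNull (λ n → s n * t n)
  null-* (B , M₁ , b₁) q N =
    let M₂ , b₂ = q (N ℤ.- B)
    in M₁ ℕ.⊔ M₂ , λ n M≤n →
         ≡.subst (λ k → [ k ] ≤⁺ _) (B+[N-B]≡N B N)
           (bound-* (b₁ n (ℕ.m⊔n≤o⇒m≤o M₁ M₂ M≤n)) (b₂ n (ℕ.m⊔n≤o⇒n≤o M₁ M₂ M≤n)))

  cauchy⇒bounded : ∀ x → EventuallyBounded (at x)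
  cauchy⇒bounded x with isCauchy x 0ℤ
  ... | M , b = B , M , λ n M≤n →
        bound-cong (x-y+y≈x (at x n) (at x M))
          (bound-+ (bound-≤ (proj₁ (proj₂ below)) (b n M M≤n ℕ.≤-refl)) (proj₂ (proj₂ below)))
    where
    below : ∃[ B ] B ℤ.≤ 0ℤ × [ B ] ≤⁺ v (at x M)
    below with v (at x M)
    ... | ⊤⁺    = 0ℤ , ℤ.≤-refl , (_ ≤⊤⁺)
    ... | [ n ] = 0ℤ ℤ.⊓ n , ℤ.i⊓j≤i 0ℤ n , [ ℤ.i⊓j≤j 0ℤ n ]
    B = proj₁ below
    x-y+y≈x : ∀ x y → x - y + y ≈ x
    x-y+y≈x x y = R.trans (R.+-assoc x (- y) y) (R.trans (R.+-congˡ (R.-‿inverseˡ y)) (R.+-identityʳ x))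

  [x+y]-[z+w] : ∀ x y z w → (x - z) + (y - w) ≈ (x + y) - (z + w)
  [x+y]-[z+w] x y z w = R.trans (interchange x (- z) y (- w)) (R.+-congˡ (⁻¹-∙-comm z w))

  [-x]-[-y] : ∀ x y → - (x - y) ≈ - x - - y
  [-x]-[-y] x y = R.sym (⁻¹-∙-comm x (- y))

  xy-zw : ∀ x y z w → x * (y - w) + w * (x - z) ≈ x * y - z * w
  xy-zw x y z w = begin
    x * (y - w) + w * (x - z)              ≈⟨ R.+-congˡ (R.*-comm w (x - z)) ⟩
    x * (y - w) + (x - z) * w              ≈⟨ R.+-cong (x[y-z]≈xy-xz x y w) ([y-z]x≈yx-zx w x z) ⟩
    (x * y - x * w) + (x * w - z * w)      ≈⟨ R.+-assoc (x * y) _ _ ⟩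
    x * y + (- (x * w) + (x * w - z * w))  ≈⟨ R.+-congˡ (R.sym (R.+-assoc _ _ _)) ⟩
    x * y + ((- (x * w) + x * w) - z * w)  ≈⟨ R.+-congˡ (R.+-congʳ (R.-‿inverseˡ _)) ⟩
    x * y + (0# - z * w)                   ≈⟨ R.+-congˡ (R.+-identityˡ _) ⟩
    x * y - z * w                          ∎
    where open import Relation.Binary.Reasoning.Setoid R.setoid

  infix  4 _≈̂_
  infixl 6 _+̂_
  infixl 7 _*̂_
  infix  8 -̂_

  _≈̂_ : CauchySequence → CauchySequence → Set
  x ≈̂ y = IsNull (λ n → at x n - at y n)

  _+̂_ _*̂_ : CauchySequence → CauchySequence → CauchySequence
  x +̂ y = mk (λ n → at x n + at y n) λ N →
    let M₁ , b₁ = isCauchy x N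
        M₂ , b₂ = isCauchy y N
    in M₁ ℕ.⊔ M₂ , λ m n p q →
         bound-cong ([x+y]-[z+w] _ _ _ _)
           (bound-+ (b₁ m n (ℕ.m⊔n≤o⇒m≤o M₁ M₂ p) (ℕ.m⊔n≤o⇒m≤o M₁ M₂ q))
                    (b₂ m n (ℕ.m⊔n≤o⇒n≤o M₁ M₂ p) (ℕ.m⊔n≤o⇒n≤o M₁ M₂ q)))
  x *̂ y = mk (λ n → at x n * at y n) λ N →
    let B , M₁ , b₁ = cauchy⇒bounded x
        C , M₂ , b₂ = cauchy⇒bounded y
        M₃ , b₃ = isCauchy y (N ℤ.- B)
        M₄ , b₄ = isCauchy x (N ℤ.- C)
        left   : ∀ {n} → M₁ ℕ.⊔ M₂ ℕ.⊔ (M₃ ℕ.⊔ M₄) ℕ.≤ n → M₁ ℕ.⊔ M₂ ℕ.≤ n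
        left   = ℕ.m⊔n≤o⇒m≤o (M₁ ℕ.⊔ M₂) (M₃ ℕ.⊔ M₄)
        right  : ∀ {n} → M₁ ℕ.⊔ M₂ ℕ.⊔ (M₃ ℕ.⊔ M₄) ℕ.≤ n → M₃ ℕ.⊔ M₄ ℕ.≤ n
        right  = ℕ.m⊔n≤o⇒n≤o (M₁ ℕ.⊔ M₂) (M₃ ℕ.⊔ M₄)
    in M₁ ℕ.⊔ M₂ ℕ.⊔ (M₃ ℕ.⊔ M₄) , λ m n p q →
         bound-cong (xy-zw _ _ _ _)
           (bound-+
             (≡.subst (λ k → [ k ] ≤⁺ _) (B+[N-B]≡N B N)
               (bound-* (b₁ m (ℕ.m⊔n≤o⇒m≤o M₁ M₂ (left p)))
                        (b₃ m n (ℕ.m⊔n≤o⇒m≤o M₃ M₄ (right p)) (ℕ.m⊔n≤o⇒m≤o M₃ M₄ (right q)))))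
             (≡.subst (λ k → [ k ] ≤⁺ _) (B+[N-B]≡N C N)
               (bound-* (b₂ n (ℕ.m⊔n≤o⇒n≤o M₁ M₂ (left q)))
                        (b₄ m n (ℕ.m⊔n≤o⇒n≤o M₃ M₄ (right p)) (ℕ.m⊔n≤o⇒n≤o M₃ M₄ (right q))))))

  -̂_ : CauchySequence → CauchySequence
  -̂ x = mk (λ n → - at x n) λ N →
    let M , b = isCauchy x N
    in M , λ m n p q → bound-cong ([-x]-[-y] _ _) (bound-neg (b m n p q))

  -- The embedding of K in its completion, by constant sequences.
  ι : Carrier → CauchySequence
  ι a = mk (λ _ → a) λ N → 0 , λ m n _ _ → bound-0 (R.-‿inverseʳ a)

  pointwise : ∀ {x y} → (∀ n → at x n ≈ at y n) → x ≈̂ y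
  pointwise {x} {y} x≈y = null-0 λ n → R.trans (R.+-congʳ (x≈y n)) (R.-‿inverseʳ (at y n))

  ≈̂-isEquivalence : IsEquivalence _≈̂_
  ≈̂-isEquivalence = record
    { refl  = λ {x} → pointwise {x} {x} λ n → R.refl
    ; sym   = λ p → null-cong (λ n → ⁻¹-anti-homo‿- _ _) (null-neg p)
    ; trans = λ p q → null-cong (λ n → telescope _ _ _) (null-+ p q)
    }
    where
    telescope : ∀ x y z → (x - y) + (y - z) ≈ x - z
    telescope x y z = R.trans (R.+-assoc x (- y) _)
      (R.+-congˡ (R.trans (R.sym (R.+-assoc (- y) y (- z)))
                 (R.trans (R.+-congʳ (R.-‿inverseˡ y)) (R.+-identityˡ (- z)))))

  *̂-cong : ∀ {x y z w} → x ≈̂ y → z ≈̂ w → (x *̂ z) ≈̂ (y *̂ w)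
  *̂-cong {x} {y} {z} {w} p q = null-cong (λ n → xy-zw _ _ _ _)
    (null-+ (null-* (cauchy⇒bounded x) q) (null-* (cauchy⇒bounded w) p))

  completion : CommutativeRing c 0ℓ
  completion = record
    { Carrier = CauchySequence
    ; _≈_     = _≈̂_
    ; _+_     = _+̂_
    ; _*_     = _*̂_
    ; -_      = -̂_
    ; 0#      = ι 0#
    ; 1#      = ι 1#
    ; isCommutativeRing = record
      { isRing = record
        { +-isAbelianGroup = record
          { isGroup = record
            { isMonoid = record
              { isSemigroup = record
                { isMagma = record
                  { isEquivalence = ≈̂-isEquivalence
                  ; ∙-cong = λ p q → null-cong (λ n → [x+y]-[z+w] _ _ _ _) (null-+ p q)
                  }
                ; assoc = λ x y z → pointwise {x +̂ y +̂ z} {x +̂ (y +̂ z)} λ n → R.+-assoc _ _ _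
                }
              ; identity = (λ x → pointwise {ι 0# +̂ x} {x} λ n → R.+-identityˡ _)
                         , (λ x → pointwise {x +̂ ι 0#} {x} λ n → R.+-identityʳ _)
              }
            ; inverse = (λ x → pointwise { -̂ x +̂ x} {ι 0#} λ n → R.-‿inverseˡ _)
                      , (λ x → pointwise {x +̂ -̂ x} {ι 0#} λ n → R.-‿inverseʳ _)
            ; ⁻¹-cong = λ p → null-cong (λ n → [-x]-[-y] _ _) (null-neg p)
            }
          ; comm = λ x y → pointwise {x +̂ y} {y +̂ x} λ n → R.+-comm _ _
          }
        ; *-cong = λ {x} {y} {z} {w} → *̂-cong {x} {y} {z} {w}
        ; *-assoc = λ x y z → pointwise {x *̂ y *̂ z} {x *̂ (y *̂ z)} λ n → R.*-assoc _ _ _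
        ; *-identity = (λ x → pointwise {ι 1# *̂ x} {x} λ n → R.*-identityˡ _)
                     , (λ x → pointwise {x *̂ ι 1#} {x} λ n → R.*-identityʳ _)
        ; distrib = (λ x y z → pointwise {x *̂ (y +̂ z)} {x *̂ y +̂ x *̂ z} λ n → R.distribˡ _ _ _)
                  , (λ x y z → pointwise {(y +̂ z) *̂ x} {y *̂ x +̂ z *̂ x} λ n → R.distribʳ _ _ _)
        }
      ; *-comm = λ x y → pointwise {x *̂ y} {y *̂ x} λ n → R.*-comm _ _
      }
    }

{-# OPTIONS --safe #-}
module Submission where

-- Everything comes down to squares modulo the maximal ideal 𝔪 of the valuation ring 𝒪.
-- By Hensel's lemma (2 is a unit), a unit that is congruent to x² + y² is a sum of two squares
-- in the completion (x or y is a unit), so it suffices to see that every unit u is congruent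
-- to a sum of two squares, constructively:
--
-- * K is finite over the fraction field k of a Euclidean domain A ⊆ 𝒪, namely ℤ, or F[Y] with
--   Y = X or Y = 1/X.  Some nonzero element of A lies in 𝔪, so A is finite modulo 𝔪, hence so is
--   k ∩ 𝒪 by the Euclidean algorithm.  A relation between the powers of u over k can be made
--   monic modulo 𝔪; thus the powers of u are finite in number modulo 𝔪, and u has finite order.
-- * The power of 2 in the order of u shows that modulo 𝔪 the element u is a square, or −1 is a
--   square, or −1 is u times a square.  Walking through 1, 2, 3, … until the first
--   nonsquare 1 + t² shows that −1 is a sum of two squares, and then so is u.
--
-- The lower bounds hold because x² has even value, and x² + y² has even value too unless the
-- leading terms cancel, in which case −1 is a square modulo 𝔪.
-- The identity a = ((a + 1)/2)² − ((a − 1)/2)² gives the upper bounds for odd values.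

open import Defs
open import Level using (Level; _⊔_)
open import Algebra.Apartness.Bundles using (HeytingField)
open import Algebra.Bundles using (CommutativeRing)
import Algebra.Definitions.RawMonoid as RawMonoidDefinitions
import Algebra.Morphism.Construct.Composition as Composition
open import Algebra.Morphism.Structures using (IsRingHomomorphism)
import Algebra.Apartness.Properties.HeytingCommutativeRing as HeytingRingProperties
import Algebra.Properties.AbelianGroup as AbelianGroupProperties
import Algebra.Properties.Ring as RingProperties
import Algebra.Properties.Semiring.Exp as Exp
import Algebra.Properties.Semiring.Mult.TCOptimised as Mult
import Algebra.Solver.Ring as RingSolver
open import Algebra.Solver.Ring.AlmostCommutativeRing
  using (fromCommutativeRing; _-Raw-AlmostCommutative⟶_)
open import Data.Fin.Base as Fin using (Fin)
import Data.Fin.Properties as Fin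
open import Data.Integer.Base as ℤ using (ℤ; +_; -[1+_]; 0ℤ; 1ℤ)
import Data.Integer.Properties as ℤ
import Data.Integer.Divisibility as ℤ∣
import Data.Integer.DivMod as ℤ
open import Data.List.Base using (List)
import Data.Maybe.Base as Maybe
open import Data.Nat.Base as ℕ using (ℕ; zero; suc)
import Data.Nat.Properties as ℕ
import Data.Nat.Induction as ℕ
import Data.Nat.Coprimality as Coprime
open import Data.Product.Base using (Σ-syntax; ∃-syntax; _×_; _,_; proj₁; proj₂)
open import Data.Rational.Base as ℚ using (ℚ; mkℚ)
import Data.Rational.Properties as ℚ
open import Data.Rational.Properties using () renaming (heytingField to ℚ-field)
import Data.Rational.Unnormalised.Base as ℚᵘ
import Data.Rational.Unnormalised.Properties as ℚᵘ
open import Data.Sum.Base using (_⊎_; inj₁; inj₂)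
open import Data.Vec.Functional using (Vector; _∷_; head; tail)
open import Function.Bundles using (Equivalence; Inverse)
open import Relation.Binary.Construct.Add.Supremum.NonStrict ℤ._≤_
  using (_≤⁺_; [_]; _≤⊤⁺; [≤]-injective)
open import Relation.Binary.Definitions using (tri<; tri≈; tri>)
open import Relation.Binary.PropositionalEquality as ≡ using (_≡_)
open import Relation.Nullary.Construct.Add.Supremum using ([_]; ⊤⁺)
open import Relation.Nullary.Decidable.Core using (yes; no; dec⇒maybe)
open import Relation.Nullary.Negation.Core using (¬_; contradiction)

-- Ring solving with integer coefficients.

module IntegerCoefficients {c ℓ : Level} (R : CommutativeRing c ℓ) where
  open CommutativeRing R
  open Mult semiring using (1+×; ×-homo-+; ×1-homo-*) renaming (_×_ to _·_)
  open RingProperties ring using (-‿distribˡ-*; -‿distribʳ-*; -‿involutive; -0#≈0#)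
  open AbelianGroupProperties +-abelianGroup using (⁻¹-∙-comm)
  open import Relation.Binary.Reasoning.Setoid setoid

  fromℤ : ℤ → Carrier
  fromℤ (+ n)    = n · 1#
  fromℤ -[1+ n ] = - (suc n · 1#)

  private
    ⊖-homo : ∀ m n → fromℤ (m ℤ.⊖ n) ≈ m · 1# - n · 1#
    ⊖-homo m zero = sym (trans (+-congˡ -0#≈0#) (+-identityʳ _))
    ⊖-homo zero (suc n) = sym (+-identityˡ _)
    ⊖-homo (suc m) (suc n) = begin
      fromℤ (suc m ℤ.⊖ suc n)              ≡⟨ ≡.cong fromℤ (ℤ.[1+m]⊖[1+n]≡m⊖n m n) ⟩
      fromℤ (m ℤ.⊖ n)                      ≈⟨ ⊖-homo m n ⟩
      m · 1# - n · 1#                      ≈⟨ +-congˡ (+-identityˡ _) ⟨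
      m · 1# + (0# - n · 1#)               ≈⟨ +-congˡ (+-congʳ (-‿inverseʳ 1#)) ⟨
      m · 1# + (1# - 1# - n · 1#)          ≈⟨ +-congˡ (+-assoc _ _ _) ⟩
      m · 1# + (1# + (- 1# - n · 1#))      ≈⟨ +-assoc _ _ _ ⟨
      m · 1# + 1# + (- 1# - n · 1#)        ≈⟨ +-cong (+-comm _ _) (⁻¹-∙-comm _ _) ⟩
      1# + m · 1# - (1# + n · 1#)          ≈⟨ +-cong (1+× m 1#) (-‿cong (1+× n 1#)) ⟨
      suc m · 1# - suc n · 1#              ∎

    +-homo : ∀ i j → fromℤ (i ℤ.+ j) ≈ fromℤ i + fromℤ j
    +-homo (+ m) (+ n) = ×-homo-+ 1# m n
    +-homo (+ m) -[1+ n ] = ⊖-homo m (suc n)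
    +-homo -[1+ m ] (+ n) = trans (⊖-homo n (suc m)) (+-comm _ _)
    +-homo -[1+ m ] -[1+ n ] = begin
      - (suc (suc (m ℕ.+ n)) · 1#)       ≡⟨ ≡.cong (λ k → - (k · 1#)) (≡.cong suc (≡.sym (ℕ.+-suc m n))) ⟩
      - ((suc m ℕ.+ suc n) · 1#)         ≈⟨ -‿cong (×-homo-+ 1# (suc m) (suc n)) ⟩
      - (suc m · 1# + suc n · 1#)        ≈⟨ ⁻¹-∙-comm _ _ ⟨
      - (suc m · 1#) - suc n · 1#        ∎

    -‿homo : ∀ i → fromℤ (ℤ.- i) ≈ - fromℤ i
    -‿homo (+ zero)  = sym -0#≈0#
    -‿homo (+ suc n) = refl
    -‿homo -[1+ n ]  = sym (-‿involutive _)

    *-homo⁺ : ∀ m n → fromℤ (+ m ℤ.* + n) ≈ fromℤ (+ m) * fromℤ (+ n)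
    *-homo⁺ m n = trans (reflexive (≡.cong fromℤ (≡.sym (ℤ.pos-* m n)))) (×1-homo-* m n)

    *-homoˡ : ∀ m j → fromℤ (+ m ℤ.* j) ≈ fromℤ (+ m) * fromℤ j
    *-homoˡ m (+ n) = *-homo⁺ m n
    *-homoˡ m -[1+ n ] = begin
      fromℤ (+ m ℤ.* -[1+ n ])              ≡⟨ ≡.cong fromℤ (ℤ.neg-distribʳ-* (+ m) (+ suc n)) ⟨
      fromℤ (ℤ.- (+ m ℤ.* + suc n))         ≈⟨ -‿homo (+ m ℤ.* + suc n) ⟩
      - fromℤ (+ m ℤ.* + suc n)             ≈⟨ -‿cong (*-homo⁺ m (suc n)) ⟩
      - (fromℤ (+ m) * fromℤ (+ suc n))     ≈⟨ -‿distribʳ-* _ _ ⟩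
      fromℤ (+ m) * fromℤ -[1+ n ]          ∎

    *-homo : ∀ i j → fromℤ (i ℤ.* j) ≈ fromℤ i * fromℤ j
    *-homo (+ m) j = *-homoˡ m j
    *-homo -[1+ m ] j = begin
      fromℤ (-[1+ m ] ℤ.* j)            ≡⟨ ≡.cong fromℤ (ℤ.neg-distribˡ-* (+ suc m) j) ⟨
      fromℤ (ℤ.- (+ suc m ℤ.* j))       ≈⟨ -‿homo (+ suc m ℤ.* j) ⟩
      - fromℤ (+ suc m ℤ.* j)           ≈⟨ -‿cong (*-homoˡ (suc m) j) ⟩
      - (fromℤ (+ suc m) * fromℤ j)     ≈⟨ -‿distribˡ-* _ _ ⟩
      fromℤ -[1+ m ] * fromℤ j          ∎

    morphism : ℤ.+-*-rawRing -Raw-AlmostCommutative⟶ fromCommutativeRing R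
    morphism = record
      { ⟦_⟧ = fromℤ ; +-homo = +-homo ; *-homo = *-homo ; -‿homo = -‿homo
      ; 0-homo = refl ; 1-homo = refl }

    open RingSolver ℤ.+-*-rawRing (fromCommutativeRing R) morphism
      (λ i j → Maybe.map (λ i≡j → reflexive (≡.cong fromℤ i≡j)) (dec⇒maybe (i ℤ.≟ j)))
      public using (solve; _:=_; con; _:+_; _:*_; _:-_; :-_)

-- Valuation ring, maximal ideal and congruence.

module Place {c ℓ₁ ℓ₂ : Level} (K : HeytingField c ℓ₁ ℓ₂) (𝔭 : FinitePlace K) where
  open HeytingField K
  open FinitePlace 𝔭
  open Completion K 𝔭
  private module R = CommutativeRing (commutativeRing K)
  open IntegerCoefficients (commutativeRing K)
  open HeytingRingProperties heytingCommutativeRing using (x-0≈x; invertibleʳ⇒#)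
  open Exp R.semiring using (_^_)
  open import Relation.Binary.Reasoning.Setoid R.setoid

  infix 4 _≋_

  HasValue : ℤ → Carrier → Set
  HasValue n x = v x ≡ [ n ]

  Unit 𝒪 𝔪 : Carrier → Set
  Unit x = HasValue 0ℤ x
  𝒪 x = [ 0ℤ ] ≤⁺ v x
  𝔪 x = [ 1ℤ ] ≤⁺ v x

  _≋_ : Carrier → Carrier → Set
  x ≋ y = 𝔪 (x - y)

  value-cong : ∀ {n x y} → x ≈ y → HasValue n x → HasValue n y
  value-cong x≈y = ≡.trans (≡.sym (v-cong x≈y))

  value-unique : ∀ {m n x} → HasValue m x → HasValue n x → m ≡ n
  value-unique p q = []-inj (≡.trans (≡.sym p) q)

  value-* : ∀ {m n x y} → HasValue m x → HasValue n y → HasValue (m ℤ.+ n) (x * y)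
  value-* p q = ≡.trans (v-* _ _) (≡.cong₂ _+⁺_ p q)

  value⇒bound : ∀ {n x} → HasValue n x → [ n ] ≤⁺ v x
  value⇒bound p rewrite p = [ ℤ.≤-refl ]

  value⇒#0 : ∀ {n x} → HasValue n x → x # 0#
  value⇒#0 p = Equivalence.from nonzero⇔finite (_ , p)

  value⇒≉0 : ∀ {n x} → HasValue n x → ¬ x ≈ 0#
  value⇒≉0 p x≈0 = #-irrefl x≈0 (value⇒#0 p)

  -- Matching on `v x` decides whether `x` vanishes: an infinite value refutes `x # 0#`, and
  -- tightness of the apartness turns this into an equality.
  zero⊎value : ∀ x → x ≈ 0# ⊎ ∃[ n ] HasValue n x
  zero⊎value x with v x in eq
  ... | [ n ] = inj₂ (n , ≡.refl)
  ... | ⊤⁺    = inj₁ (proj₁ (tight x 0#) λ x#0 →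
    case-⊤ (≡.trans (≡.sym eq) (proj₂ (Equivalence.to nonzero⇔finite x#0))))
    where
    case-⊤ : ∀ {n : ℤ} → ¬ (⊤⁺ ≡ [ n ])
    case-⊤ ()

  value-bound : ∀ {m n x} → HasValue m x → [ n ] ≤⁺ v x → n ℤ.≤ m
  value-bound p b rewrite p = [≤]-injective b

  inverse : ∀ {n x} → HasValue n x → ∃[ y ] x * y ≈ 1#
  inverse {x = x} p with #⇒invertible (value⇒#0 p)
  ... | y , _ , [x-0]y≈1 = y , R.trans (R.*-congʳ (R.sym (x-0≈x x))) [x-0]y≈1

  invertible⇒value : ∀ {x y} → x * y ≈ 1# → ∃[ n ] HasValue n x
  invertible⇒value {x} {y} xy≈1 = Equivalence.to nonzero⇔finite
    (invertibleʳ⇒# (y , R.trans (R.*-congʳ (x-0≈x x)) xy≈1))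

  value-*ʳ : ∀ {m n x y} → HasValue m x → HasValue n (x * y) → HasValue (n ℤ.- m) y
  value-*ʳ {m} {n} {x} {y} p q with zero⊎value y
  ... | inj₁ y≈0 = contradiction (R.trans (R.*-congˡ y≈0) (R.zeroʳ x)) (value⇒≉0 q)
  ... | inj₂ (k , r) = ≡.trans r (≡.cong [_] 
      (≡.trans (≡.sym (k+m-m m k)) (≡.cong (ℤ._- m) (value-unique (value-* p r) q))))
    where
    k+m-m : ∀ m k → m ℤ.+ k ℤ.- m ≡ k
    k+m-m m k = ≡.trans (≡.cong (ℤ._- m) (ℤ.+-comm m k))
      (≡.trans (ℤ.+-assoc k m (ℤ.- m)) (≡.trans (≡.cong (λ l → k ℤ.+ l) (ℤ.+-inverseʳ m)) (ℤ.+-identityʳ k)))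

  value-inverse : ∀ {n x y} → HasValue n x → x * y ≈ 1# → HasValue (ℤ.- n) y
  value-inverse {n} p xy≈1 =
    ≡.trans (value-*ʳ p (value-cong (R.sym xy≈1) v-1)) (≡.cong [_] (ℤ.+-identityˡ (ℤ.- n)))

  *-cancelˡ : ∀ {n x y z} → HasValue n x → x * y ≈ x * z → y ≈ z
  *-cancelˡ {x = x} {y} {z} p xy≈xz with inverse p
  ... | w , xw≈1 = begin
    y            ≈⟨ solve 1 (λ y → y := con 1ℤ :* y) R.refl y ⟩
    1# * y       ≈⟨ R.*-congʳ (R.sym xw≈1) ⟩
    x * w * y    ≈⟨ solve 3 (λ x y w → x :* w :* y := w :* (x :* y)) R.refl x y w ⟩
    w * (x * y)  ≈⟨ R.*-congˡ xy≈xz ⟩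
    w * (x * z)  ≈⟨ solve 3 (λ x z w → w :* (x :* z) := x :* w :* z) R.refl x z w ⟩
    x * w * z    ≈⟨ R.*-congʳ xw≈1 ⟩
    1# * z       ≈⟨ solve 1 (λ y → con 1ℤ :* y := y) R.refl z ⟩
    z            ∎

  bound-- : ∀ {N x y} → [ N ] ≤⁺ v x → [ N ] ≤⁺ v y → [ N ] ≤⁺ v (x - y)
  bound-- p q = bound-+ p (bound-neg q)

  -- The ultrametric triangle is isosceles. If `v y` were above `n`, then `x = (x − y) + y` would
  -- have value above `n`; if it were below, then `y = x − (x − y)` would have value above its own.
  isosceles : ∀ {n x y} → HasValue n x → [ ℤ.suc n ] ≤⁺ v (x - y) → HasValue n y
  isosceles {n} {x} {y} p q with v y in eq
  ... | ⊤⁺ = contradiction (value-bound p (bound-cong x-y+y (bound-+ q (≡.subst (_ ≤⁺_) (≡.sym eq) (_ ≤⊤⁺)))))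
                           (λ le → ℤ.<-irrefl ≡.refl (ℤ.suc[i]≤j⇒i<j le))
    where
    x-y+y : x - y + y ≈ x
    x-y+y = solve 2 (λ x y → x :- y :+ y := x) R.refl x y
  ... | [ m ] with ℤ.<-cmp m n
  ... | tri≈ _ m≡n _ = ≡.cong [_] m≡n
  ... | tri> _ _ n<m = contradiction
          (value-bound p (bound-cong (solve 2 (λ x y → x :- y :+ y := x) R.refl x y)
            (bound-+ q (bound-≤ (ℤ.i<j⇒suc[i]≤j n<m) (value⇒bound eq)))))
          (λ le → ℤ.<-irrefl ≡.refl (ℤ.suc[i]≤j⇒i<j le))
  ... | tri< m<n _ _ = contradiction
          (value-bound eq (bound-cong (solve 2 (λ x y → x :- (x :- y) := y) R.refl x y)
            (bound-- (bound-≤ (ℤ.i<j⇒suc[i]≤j m<n) (value⇒bound p))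
                     (bound-≤ (ℤ.suc-mono (ℤ.<⇒≤ m<n)) q))))
          (λ le → ℤ.<-irrefl ≡.refl (ℤ.suc[i]≤j⇒i<j le))

  𝔪⇒𝒪 : ∀ {x} → 𝔪 x → 𝒪 x
  𝔪⇒𝒪 = bound-≤ (ℤ.+≤+ ℕ.z≤n)

  𝒪-1 : 𝒪 1#
  𝒪-1 = value⇒bound v-1

  𝔪-*ˡ : ∀ {x y} → 𝒪 x → 𝔪 y → 𝔪 (x * y)
  𝔪-*ˡ = bound-*

  𝔪-*ʳ : ∀ {x y} → 𝔪 x → 𝒪 y → 𝔪 (x * y)
  𝔪-*ʳ = bound-*

  𝒪-^ : ∀ {x} → 𝒪 x → ∀ n → 𝒪 (x ^ n)
  𝒪-^ p zero    = 𝒪-1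
  𝒪-^ p (suc n) = bound-* p (𝒪-^ p n)

  unit-^ : ∀ {x} → Unit x → ∀ n → Unit (x ^ n)
  unit-^ p zero    = v-1
  unit-^ p (suc n) = value-* p (unit-^ p n)

  unit⇒∉𝔪 : ∀ {x} → Unit x → ¬ 𝔪 x
  unit⇒∉𝔪 p q with value-bound p q
  ... | ℤ.+≤+ ()

  unit⊎𝔪 : ∀ {x} → 𝒪 x → Unit x ⊎ 𝔪 x
  unit⊎𝔪 {x} p with v x in eq
  ... | ⊤⁺               = inj₂ (_ ≤⊤⁺)
  ... | [ + zero ]       = inj₁ ≡.refl
  ... | [ + suc n ]      = inj₂ [ ℤ.+≤+ (ℕ.s≤s ℕ.z≤n) ]
  unit⊎𝔪 {x} [ () ] | [ -[1+ n ] ]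

  𝔪-*-cancelˡ : ∀ {x y} → Unit x → 𝔪 (x * y) → 𝔪 y
  𝔪-*-cancelˡ {x} {y} p q with inverse p
  ... | w , xw≈1 = bound-cong wxy≈y (𝔪-*ˡ (value⇒bound (value-inverse p xw≈1)) q)
    where
    wxy≈y : w * (x * y) ≈ y
    wxy≈y = R.trans (solve 3 (λ x y w → w :* (x :* y) := x :* w :* y) R.refl x y w)
                    (R.trans (R.*-congʳ xw≈1) (R.*-identityˡ y))

  𝔪-prime : ∀ {x y} → 𝒪 x → 𝔪 (x * y) → 𝔪 x ⊎ 𝔪 y
  𝔪-prime p q with unit⊎𝔪 p
  ... | inj₁ u = inj₂ (𝔪-*-cancelˡ u q)
  ... | inj₂ m = inj₁ m

  ≋-reflexive : ∀ {x y} → x ≈ y → x ≋ y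
  ≋-reflexive {x} {y} x≈y = bound-0 (R.trans (R.+-congʳ x≈y) (R.-‿inverseʳ y))

  ≋-refl : ∀ {x} → x ≋ x
  ≋-refl = ≋-reflexive R.refl

  ≋-sym : ∀ {x y} → x ≋ y → y ≋ x
  ≋-sym {x} {y} p = bound-cong (solve 2 (λ x y → :- (x :- y) := y :- x) R.refl x y) (bound-neg p)

  ≋-trans : ∀ {x y z} → x ≋ y → y ≋ z → x ≋ z
  ≋-trans {x} {y} {z} p q =
    bound-cong (solve 3 (λ x y z → (x :- y) :+ (y :- z) := x :- z) R.refl x y z) (bound-+ p q)

  ≋-+ : ∀ {x y z w} → x ≋ y → z ≋ w → x + z ≋ y + w
  ≋-+ {x} {y} {z} {w} p q = bound-cong
    (solve 4 (λ x y z w → (x :- y) :+ (z :- w) := (x :+ z) :- (y :+ w)) R.refl x y z w) (bound-+ p q)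

  ≋-*ˡ : ∀ {x y z} → 𝒪 x → y ≋ z → x * y ≋ x * z
  ≋-*ˡ {x} {y} {z} o p = bound-cong
    (solve 3 (λ x y z → x :* (y :- z) := x :* y :- x :* z) R.refl x y z) (𝔪-*ˡ o p)

  ≋-* : ∀ {x y z w} → 𝒪 x → 𝒪 w → x ≋ y → z ≋ w → x * z ≋ y * w
  ≋-* {x} {y} {z} {w} ox ow p q = bound-cong
    (solve 4 (λ x y z w → x :* (z :- w) :+ w :* (x :- y) := x :* z :- y :* w) R.refl x y z w)
    (bound-+ (𝔪-*ˡ ox q) (𝔪-*ˡ ow p))

  𝒪-≋ : ∀ {x y} → x ≋ y → 𝒪 y → 𝒪 x
  𝒪-≋ {x} {y} p o = bound-cong (solve 2 (λ x y → (x :- y) :+ y := x) R.refl x y) (bound-+ (𝔪⇒𝒪 p) o)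

-- Finiteness up to a relation.

FiniteUpTo : ∀ {a r p} {A : Set a} → (A → A → Set r) → (A → Set p) → Set (a ⊔ r ⊔ p)
FiniteUpTo {A = A} _~_ P = ∃[ q ] Σ[ r ∈ Vector A q ] (∀ x → P x → ∃[ i ] x ~ r i)

-- Two of the first `q + 1` terms share one of the `q` representatives. The later index has the form
-- `suc k + i`, so that for powers a factor of positive exponent splits off.
pigeonhole : ∀ {a r p} {A : Set a} {_~_ : A → A → Set r} {P : A → Set p} →
             (∀ {x y z} → x ~ z → y ~ z → x ~ y) → FiniteUpTo _~_ P →
             ∀ (f : ℕ → A) → (∀ n → P (f n)) → ∃[ i ] ∃[ k ] f i ~ f (suc k ℕ.+ i)
pigeonhole {_~_ = _~_} join (q , r , cover) f Pf
  with Fin.pigeonhole (ℕ.n<1+n q) (λ i → proj₁ (cover (f (Fin.toℕ i)) (Pf (Fin.toℕ i))))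
... | i , j , i<j , eq with ℕ.m≤n⇒∃[o]m+o≡n i<j
... | k , eq′ = Fin.toℕ i , k , ≡.subst (λ l → f (Fin.toℕ i) ~ f l)
        (≡.trans (≡.sym eq′) (≡.cong suc (ℕ.+-comm (Fin.toℕ i) k)))
        (join (proj₂ (cover _ (Pf (Fin.toℕ i))))
              (≡.subst (λ l → f (Fin.toℕ j) ~ r l) (≡.sym eq) (proj₂ (cover _ (Pf (Fin.toℕ j))))))

-- Values of polynomials over a subring, and division by monic ones.

module Polynomials {c ℓ : Level} (R : CommutativeRing c ℓ) where
  open CommutativeRing R hiding (zero)
  open IntegerCoefficients R
  open Exp semiring using (_^_)
  open import Relation.Binary.Reasoning.Setoid setoid

  record IsSubring {p} (B : Carrier → Set p) : Set (c ⊔ ℓ ⊔ p) where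
    field
      resp : ∀ {x y} → x ≈ y → B x → B y
      ∈-1  : B 1#
      ∈-+  : ∀ {x y} → B x → B y → B (x + y)
      ∈-*  : ∀ {x y} → B x → B y → B (x * y)
      ∈-neg : ∀ {x} → B x → B (- x)

    ∈-0 : B 0#
    ∈-0 = resp (-‿inverseʳ 1#) (∈-+ ∈-1 (∈-neg ∈-1))

    ∈-^ : ∀ {x} → B x → ∀ n → B (x ^ n)
    ∈-^ b zero    = ∈-1
    ∈-^ b (suc n) = ∈-* b (∈-^ b n)

  -- Poly B u n x: x is the value at u of a polynomial over B with n coefficients.
  data Poly {p} (B : Carrier → Set p) (u : Carrier) : ℕ → Carrier → Set (c ⊔ ℓ ⊔ p) where
    nil  : ∀ {x} → x ≈ 0# → Poly B u zero x
    cons : ∀ {n x b y} → B b → Poly B u n y → x ≈ b + u * y → Poly B u (suc n) x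

  -- Monic B u d x: x is the value at u of a monic polynomial over B of degree d.
  data Monic {p} (B : Carrier → Set p) (u : Carrier) : ℕ → Carrier → Set (c ⊔ ℓ ⊔ p) where
    one  : ∀ {x} → x ≈ 1# → Monic B u zero x
    cons : ∀ {n x b y} → B b → Monic B u n y → x ≈ b + u * y → Monic B u (suc n) x

  module _ {p} {B : Carrier → Set p} (isSubring : IsSubring B) (u : Carrier) where
    open IsSubring isSubring

    poly-resp : ∀ {n x y} → x ≈ y → Poly B u n x → Poly B u n y
    poly-resp x≈y (nil x≈0)    = nil (trans (sym x≈y) x≈0)
    poly-resp x≈y (cons b p e) = cons b p (trans (sym x≈y) e)

    poly-0 : ∀ n → Poly B u n 0#
    poly-0 zero    = nil refl
    poly-0 (suc n) = cons ∈-0 (poly-0 n) (solve 1 (λ u → con 0ℤ := con 0ℤ :+ u :* con 0ℤ) refl u)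

    poly-suc : ∀ {n x} → Poly B u n x → Poly B u (suc n) x
    poly-suc (nil x≈0)    = poly-resp (sym x≈0) (poly-0 1)
    poly-suc (cons b p e) = cons b (poly-suc p) e

    poly-+ : ∀ {n x y} → Poly B u n x → Poly B u n y → Poly B u n (x + y)
    poly-+ (nil x≈0) (nil y≈0) = nil (trans (+-cong x≈0 y≈0) (+-identityˡ 0#))
    poly-+ (cons {b = b} {x} ∈b p e) (cons {b = b′} {y} ∈b′ p′ e′) =
      cons (∈-+ ∈b ∈b′) (poly-+ p p′) (trans (+-cong e e′)
        (solve 5 (λ b b′ u x y → (b :+ u :* x) :+ (b′ :+ u :* y) := (b :+ b′) :+ u :* (x :+ y))
          refl b b′ u x y))

    poly-scale : ∀ {n b x} → B b → Poly B u n x → Poly B u n (b * x)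
    poly-scale {b = b} ∈b (nil x≈0) = nil (trans (*-congˡ x≈0) (zeroʳ b))
    poly-scale {b = b} ∈b (cons {b = a} {y} ∈a p e) = cons (∈-* ∈b ∈a) (poly-scale ∈b p)
      (trans (*-congˡ e) (solve 4 (λ b a u y → b :* (a :+ u :* y) := b :* a :+ u :* (b :* y)) refl b a u y))

    poly-neg : ∀ {n x} → Poly B u n x → Poly B u n (- x)
    poly-neg {x = x} p = poly-resp (solve 1 (λ x → (:- con 1ℤ) :* x := :- x) refl x)
      (poly-scale (∈-neg ∈-1) p)

    poly-shift : ∀ {n x} → Poly B u n x → Poly B u (suc n) (u * x)
    poly-shift p = cons ∈-0 p (sym (+-identityˡ _))

    poly-const : ∀ {b} → B b → Poly B u 1 b
    poly-const {b} ∈b = cons ∈b (nil refl) (solve 2 (λ b u → b := b :+ u :* con 0ℤ) refl b u)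

    poly-≤ : ∀ {m n x} → m ℕ.≤ n → Poly B u m x → Poly B u n x
    poly-≤ {n = n} ℕ.z≤n (nil x≈0) = poly-resp (sym x≈0) (poly-0 n)
    poly-≤ (ℕ.s≤s le) (cons b p e) = cons b (poly-≤ le p) e

    poly-* : ∀ {m n x y} → Poly B u m x → Poly B u n y → Poly B u (m ℕ.+ n) (x * y)
    poly-* {n = n} {y = y} (nil x≈0) q = poly-resp (sym (trans (*-congʳ x≈0) (zeroˡ y))) (poly-0 n)
    poly-* {suc m} {n} {y = y} (cons {b = b} {x} ∈b p e) q = poly-resp
      (trans (solve 4 (λ b u x y → b :* y :+ u :* (x :* y) := (b :+ u :* x) :* y) refl b u x y)
             (*-congʳ (sym e)))
      (poly-+ (poly-≤ (ℕ.m≤n+m n (suc m)) (poly-scale ∈b q)) (poly-shift (poly-* p q)))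

    poly-^ : ∀ n → Poly B u (suc n) (u ^ n)
    poly-^ zero    = poly-const ∈-1
    poly-^ (suc n) = poly-shift (poly-^ n)

    poly-isSubring : IsSubring (λ x → ∃[ n ] Poly B u n x)
    poly-isSubring = record
      { resp  = λ { x≈y (n , p) → n , poly-resp x≈y p }
      ; ∈-1   = 1 , poly-const ∈-1
      ; ∈-+   = λ { (m , p) (n , q) → m ℕ.+ n ,
                    poly-+ (poly-≤ (ℕ.m≤m+n m n) p) (poly-≤ (ℕ.m≤n+m n m) q) }
      ; ∈-*   = λ { (m , p) (n , q) → m ℕ.+ n , poly-* p q }
      ; ∈-neg = λ { (n , p) → n , poly-neg p }
      }

    monic-resp : ∀ {d x y} → x ≈ y → Monic B u d x → Monic B u d y
    monic-resp x≈y (one x≈1)    = one (trans (sym x≈y) x≈1)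
    monic-resp x≈y (cons b m e) = cons b m (trans (sym x≈y) e)

    power+poly⇒monic : ∀ {d x} → Poly B u d x → Monic B u d (u ^ d + x)
    power+poly⇒monic (nil x≈0) = one (trans (+-congˡ x≈0) (+-identityʳ 1#))
    power+poly⇒monic {suc d} (cons {b = b} {y} ∈b p e) = cons ∈b (power+poly⇒monic p)
      (trans (+-congˡ e) (solve 4 (λ u w b y → u :* w :+ (b :+ u :* y) := b :+ u :* (w :+ y)) refl u (u ^ d) b y))

    private
      -- Here `t` is the coefficient of `u ^ d` in the given expression for `x`; subtracting `t * m`
      -- cancels that term because `m` is monic of degree `d`.
      monic-reduce : ∀ {d m x} → Monic B u d m → Poly B u (suc d) x →
                     ∃[ t ] B t × Poly B u d (x - t * m)
      monic-reduce {m = m} {x} (one m≈1) (cons {b = b} {y} ∈b (nil y≈0) e) = b , ∈b , nil (begin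
        x - b * m             ≈⟨ +-cong (trans e (+-congˡ (*-congˡ y≈0))) (-‿cong (*-congˡ m≈1)) ⟩
        b + u * 0# - b * 1#   ≈⟨ solve 2 (λ b u → (b :+ u :* con 0ℤ) :- b :* con 1ℤ := con 0ℤ) refl b u ⟩
        0#                    ∎)
      monic-reduce {m = m} {x} (cons {b = a} {z} ∈a q e) (cons {b = b} {y} ∈b p e′)
        with monic-reduce q p
      ... | t , ∈t , r = t , ∈t , cons (∈-+ ∈b (∈-neg (∈-* ∈t ∈a))) r (begin
        x - t * m                            ≈⟨ +-cong e′ (-‿cong (*-congˡ e)) ⟩
        b + u * y - t * (a + u * z)          ≈⟨ solve 6 (λ a b t u y z →
          (b :+ u :* y) :- t :* (a :+ u :* z) := (b :- t :* a) :+ u :* (y :- t :* z)) refl a b t u y z ⟩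
        b - t * a + u * (y - t * z)          ∎)

    -- Long division in Horner form. If `x = b + u y` and `y = q m + r`, then `b + u r` has `d + 1`
    -- coefficients, one too many, and `monic-reduce` moves the excess into the quotient.
    division : ∀ {n d x m} → Monic B u d m → Poly B u n x →
               ∃[ q ] ∃[ r ] Poly B u n q × Poly B u d r × x ≈ q * m + r
    division {d = d} {m = m} M (nil x≈0) = 0# , 0# , nil refl , poly-0 d ,
      trans x≈0 (solve 1 (λ m → con 0ℤ := con 0ℤ :* m :+ con 0ℤ) refl m)
    division {x = x} {m = m} M (cons {b = b} {y} ∈b p e) with division M p
    ... | q , r , Q , S , e′ with monic-reduce M (cons ∈b S refl)
    ... | t , ∈t , S′ = t + u * q , _ , cons ∈t Q refl , S′ , (begin
      x                                              ≈⟨ trans e (+-congˡ (*-congˡ e′)) ⟩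
      b + u * (q * m + r)                            ≈⟨ solve 6 (λ b u q m r t →
         b :+ u :* (q :* m :+ r) := (t :+ u :* q) :* m :+ ((b :+ u :* r) :- t :* m)) refl b u q m r t ⟩
      (t + u * q) * m + (b + u * r - t * m)          ∎)

  poly⊆ : ∀ {p q} {B : Carrier → Set p} {C : Carrier → Set q} {u} → IsSubring C →
          (∀ {y} → B y → C y) → C u → ∀ {n x} → Poly B u n x → C x
  poly⊆ S f ∈u (nil e)      = IsSubring.resp S (sym e) (IsSubring.∈-0 S)
  poly⊆ S f ∈u (cons b p e) =
    IsSubring.resp S (sym e) (IsSubring.∈-+ S (f b) (IsSubring.∈-* S ∈u (poly⊆ S f ∈u p)))

  monic⊆ : ∀ {p q} {B : Carrier → Set p} {C : Carrier → Set q} {u} → IsSubring C →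
           (∀ {y} → B y → C y) → C u → ∀ {n x} → Monic B u n x → C x
  monic⊆ S f ∈u (one e)      = IsSubring.resp S (sym e) (IsSubring.∈-1 S)
  monic⊆ S f ∈u (cons b p e) =
    IsSubring.resp S (sym e) (IsSubring.∈-+ S (f b) (IsSubring.∈-* S ∈u (monic⊆ S f ∈u p)))

-- Finiteness modulo the maximal ideal.

module Residue {c ℓ₁ ℓ₂ : Level} (K : HeytingField c ℓ₁ ℓ₂) (𝔭 : FinitePlace K) where
  open HeytingField K
  open FinitePlace 𝔭
  open Completion K 𝔭
  open Place K 𝔭
  private module R = CommutativeRing (commutativeRing K)
  open IntegerCoefficients (commutativeRing K)
  open Polynomials (commutativeRing K)
  open Exp R.semiring using (_^_; ^-homo-*)
  open import Relation.Binary.Reasoning.Setoid R.setoid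

  𝒪-isSubring : IsSubring 𝒪
  𝒪-isSubring = record
    { resp = bound-cong ; ∈-1 = 𝒪-1 ; ∈-+ = bound-+ ; ∈-* = bound-* ; ∈-neg = bound-neg }

  ∩𝒪-isSubring : ∀ {p} {B : Carrier → Set p} → IsSubring B → IsSubring (λ x → B x × 𝒪 x)
  ∩𝒪-isSubring S = record
    { resp  = λ { e (b , o) → S.resp e b , bound-cong e o }
    ; ∈-1   = S.∈-1 , 𝒪-1
    ; ∈-+   = λ { (b , o) (b′ , o′) → S.∈-+ b b′ , bound-+ o o′ }
    ; ∈-*   = λ { (b , o) (b′ , o′) → S.∈-* b b′ , bound-* o o′ }
    ; ∈-neg = λ { (b , o) → S.∈-neg b , bound-neg o }
    }
    where module S = IsSubring S

  Covered : ∀ {p} → (Carrier → Set p) → Set (c ⊔ p)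
  Covered = FiniteUpTo _≋_

  covered-⊆ : ∀ {p q} {P : Carrier → Set p} {Q : Carrier → Set q} →
              (∀ {x} → Q x → ∃[ y ] P y × x ≋ y) → Covered P → Covered Q
  covered-⊆ f (n , r , cover) = n , r , λ x q →
    let y , p , x≋y = f q
        i , y≋r     = cover y p
    in i , ≋-trans x≋y y≋r

  -- Pairs of representatives represent the combinations. This is the induction step on the number
  -- of coefficients of a polynomial in `u`; with `u = −1` it handles differences.
  covered-affine : ∀ {p q} {P : Carrier → Set p} {Q : Carrier → Set q} {u} → 𝒪 u →
                   Covered P → Covered Q →
                   Covered (λ z → ∃[ x ] ∃[ y ] P x × Q y × z ≈ x + u * y)
  covered-affine {u = u} o (m , r , cover) (n , s , cover′) = m ℕ.* n , t , λ { z (x , y , px , qy , z≈) →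
      let i , x≋ = cover x px
          j , y≋ = cover′ y qy
      in Fin.combine i j , ≡.subst (z ≋_)
           (≡.cong (λ ij → r (proj₁ ij) + u * s (proj₂ ij)) (≡.sym (Fin.remQuot-combine i j)))
           (≋-trans (≋-reflexive z≈) (≋-+ x≋ (≋-*ˡ o y≋))) }
    where
    t : Vector Carrier (m ℕ.* n)
    t k = let i , j = Fin.remQuot n k in r i + u * s j

  covered-poly : ∀ {p} {B : Carrier → Set p} {u} → 𝒪 u → Covered B → ∀ n → Covered (Poly B u n)
  covered-poly o C zero    = 1 , (λ _ → 0#) , λ { x (nil x≈0) → Fin.zero , ≋-reflexive x≈0 }
  covered-poly o C (suc n) =
    covered-⊆ (λ { {x} (cons b p e) → x , (_ , _ , b , p , e) , ≋-refl })
      (covered-affine o C (covered-poly o C n))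

  -- The pigeonhole principle gives `u ^ i ≋ u ^ (N + 1 + i)`, and the unit `u ^ i` cancels from the
  -- difference `u ^ i * (1 − u ^ (N + 1))`.
  unit⇒torsion : ∀ {p} {P : Carrier → Set p} {u} → Covered P → (∀ n → P (u ^ n)) → Unit u →
                 ∃[ N ] u ^ suc N ≋ 1#
  unit⇒torsion {u = u} C Pu unit
    with pigeonhole (λ x≋z y≋z → ≋-trans x≋z (≋-sym y≋z)) C (u ^_) Pu
  ... | i , N , uⁱ≋ = N , ≋-sym (𝔪-*-cancelˡ (unit-^ unit i) (bound-cong eq uⁱ≋))
    where
    eq : u ^ i - u ^ (suc N ℕ.+ i) ≈ u ^ i * (1# - u ^ suc N)
    eq = R.trans (R.+-congˡ (R.-‿cong (^-homo-* u (suc N) i)))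
      (solve 2 (λ x y → x :- y :* x := x :* (con 1ℤ :- y)) R.refl (u ^ i) (u ^ suc N))

  -- Linear algebra and polynomial relations over a subfield.

  record IsSubfield {p} (k : Carrier → Set p) : Set (c ⊔ ℓ₁ ⊔ p) where
    field
      isSubring : IsSubring k
      ∈-inverse : ∀ {n x} → k x → HasValue n x → ∃[ y ] k y × x * y ≈ 1#
    open IsSubring isSubring public

  data Span {p} (k : Carrier → Set p) : ∀ {n} → Vector Carrier n → Carrier → Set (c ⊔ ℓ₁ ⊔ p) where
    nil  : ∀ {g : Vector Carrier 0} {x} → x ≈ 0# → Span k g x
    cons : ∀ {n} {g : Vector Carrier (suc n)} {a x y} →
           k a → Span k (tail g) y → x ≈ a * head g + y → Span k g x

  module _ {p} {k : Carrier → Set p} (isSubfield : IsSubfield k) where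
    open IsSubfield isSubfield

    span-+ : ∀ {n} {g : Vector Carrier n} {x y} → Span k g x → Span k g y → Span k g (x + y)
    span-+ (nil x≈0) (nil y≈0) = nil (R.trans (R.+-cong x≈0 y≈0) (R.+-identityˡ 0#))
    span-+ {g = g} (cons {a = a} {y = x} ∈a p e) (cons {a = b} {y = y} ∈b q e′) =
      cons (∈-+ ∈a ∈b) (span-+ p q) (R.trans (R.+-cong e e′)
        (solve 5 (λ a b h x y → (a :* h :+ x) :+ (b :* h :+ y) := (a :+ b) :* h :+ (x :+ y))
          R.refl a b (head g) x y))

    span-scale : ∀ {n} {g : Vector Carrier n} {b x} → k b → Span k g x → Span k g (b * x)
    span-scale {b = b} ∈b (nil x≈0) = nil (R.trans (R.*-congˡ x≈0) (R.zeroʳ b))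
    span-scale {g = g} {b} ∈b (cons {a = a} {y = y} ∈a p e) =
      cons (∈-* ∈b ∈a) (span-scale ∈b p) (R.trans (R.*-congˡ e)
        (solve 4 (λ a b h y → b :* (a :* h :+ y) := b :* a :* h :+ b :* y) R.refl a b (head g) y))

    -- Steinitz's exchange step: the first generator with a nonzero coefficient in `w` is dropped,
    -- since dividing by that coefficient expresses it by `w` and the later generators. `zero⊎value`
    -- makes the search for it effective.
    exchange : ∀ {n} {g : Vector Carrier (suc n)} {w} → Span k g w →
      w ≈ 0# ⊎ (Σ[ g′ ∈ Vector Carrier n ] (∀ {y} → Span k g y →
        ∃[ b ] ∃[ z ] k b × Span k g′ z × y ≈ b * w + z))
    exchange {n} {g} {w} (cons {a = a} {y = w′} ∈a p e) with zero⊎value a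
    ... | inj₂ (_ , va) = inj₂ (tail g , λ { {y} (cons {a = b} {y = y′} ∈b q e′) →
      let a⁻¹ , ∈a⁻¹ , aa⁻¹≈1 = ∈-inverse ∈a va
          ba⁻¹ = ∈-* ∈b ∈a⁻¹
      in b * a⁻¹ , - (b * a⁻¹) * w′ + y′ , ba⁻¹ , span-+ (span-scale (∈-neg ba⁻¹) p) q , (begin
        y                                                      ≈⟨ e′ ⟩
        b * head g + y′                                        ≈⟨ solve 3 (λ b h y →
          b :* h :+ y := b :* (con 1ℤ :* h) :+ y) R.refl b (head g) y′ ⟩
        b * (1# * head g) + y′                                 ≈⟨ R.+-congʳ (R.*-congˡ (R.*-congʳ (R.sym aa⁻¹≈1))) ⟩
        b * (a * a⁻¹ * head g) + y′                            ≈⟨ solve 6 (λ a b i h w y →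
          b :* (a :* i :* h) :+ y :=
          b :* i :* (a :* h :+ w) :+ ((:- (b :* i)) :* w :+ y)) R.refl a b a⁻¹ (head g) w′ y′ ⟩
        b * a⁻¹ * (a * head g + w′) + (- (b * a⁻¹) * w′ + y′)  ≈⟨ R.+-congʳ (R.*-congˡ (R.sym e)) ⟩
        b * a⁻¹ * w + (- (b * a⁻¹) * w′ + y′)                  ∎) })
    ... | inj₁ a≈0 = later p
      where
      w≈w′ : w ≈ w′
      w≈w′ = R.trans e (R.trans (R.+-congʳ (R.trans (R.*-congʳ a≈0) (R.zeroˡ _))) (R.+-identityˡ w′))
      -- The length is generalised so that the tail can be analysed as empty, which leaves `w ≈ 0#`,
      -- or as nonempty, where the exchange takes place further on and `head g` is kept.
      later : ∀ {m} {g : Vector Carrier (suc m)} → Span k (tail g) w′ →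
        w ≈ 0# ⊎ (Σ[ g′ ∈ Vector Carrier m ] (∀ {y} → Span k g y →
          ∃[ b ] ∃[ z ] k b × Span k g′ z × y ≈ b * w + z))
      later {zero} (nil w′≈0) = inj₁ (R.trans w≈w′ w′≈0)
      later {suc m} {g} p with exchange p
      ... | inj₁ w′≈0 = inj₁ (R.trans w≈w′ w′≈0)
      ... | inj₂ (g′ , f) = inj₂ (head g ∷ g′ , λ { {y} (cons {a = d} {y = y′} ∈d q e′) →
        let b , z , ∈b , r , e″ = f q
        in b , d * head g + z , ∈b , cons ∈d r R.refl , (begin
          y                              ≈⟨ R.trans e′ (R.+-congˡ e″) ⟩
          d * head g + (b * w′ + z)      ≈⟨ solve 3 (λ x y z → x :+ (y :+ z) := y :+ (x :+ z)) R.refl (d * head g) (b * w′) z ⟩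
          b * w′ + (d * head g + z)      ≈⟨ R.+-congʳ (R.*-congˡ (R.sym w≈w′)) ⟩
          b * w + (d * head g + z)       ∎) })

    -- Steinitz exchange: every power of u outside the span of the lower ones replaces a generator.
    power-dependent : ∀ u n j (g : Vector Carrier n) →
      (∀ y → ∃[ x ] ∃[ w ] Poly k u j x × Span k g w × y ≈ x + w) → ∃[ d ] Poly k u d (u ^ d)
    power-dependent u zero j g spans with spans (u ^ j)
    ... | x , w , P , nil w≈0 , e = j , poly-resp isSubring u
          (R.sym (R.trans e (R.trans (R.+-congˡ w≈0) (R.+-identityʳ x)))) P
    power-dependent u (suc n) j g spans with spans (u ^ j)
    ... | x , w , P , W , e with exchange W
    ... | inj₁ w≈0 = j , poly-resp isSubring u
          (R.sym (R.trans e (R.trans (R.+-congˡ w≈0) (R.+-identityʳ x)))) P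
    ... | inj₂ (g′ , f) = power-dependent u n (suc j) g′ λ y →
      let x′ , w′ , P′ , W′ , e′ = spans y
          b , z , ∈b , Z , e″ = f W′
      in x′ + b * (u ^ j - x) , z
       , poly-+ isSubring u (poly-suc isSubring u P′) (poly-scale isSubring u ∈b
           (poly-+ isSubring u (poly-^ isSubring u j) (poly-neg isSubring u (poly-suc isSubring u P))))
       , Z , (begin
         y                                ≈⟨ R.trans e′ (R.+-congˡ e″) ⟩
         x′ + (b * w + z)                 ≈⟨ solve 5 (λ x′ b w z x →
            x′ :+ (b :* w :+ z) := (x′ :+ b :* ((x :+ w) :- x)) :+ z) R.refl x′ b w z x ⟩
         x′ + b * (x + w - x) + z         ≈⟨ R.+-congʳ (R.+-congˡ (R.*-congˡ (R.+-congʳ (R.sym e)))) ⟩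
         x′ + b * (u ^ j - x) + z         ∎)

    algebraic : ∀ {n} (g : Vector Carrier n) → (∀ y → Span k g y) → ∀ u → ∃[ d ] Monic k u d 0#
    algebraic g spans u with power-dependent u _ 0 g
      (λ y → 0# , y , nil R.refl , spans y , R.sym (R.+-identityˡ y))
    ... | d , P = d , monic-resp isSubring u (R.-‿inverseʳ (u ^ d))
      (power+poly⇒monic isSubring u (poly-neg isSubring u P))

    -- The factor `e` is the inverse of the last nonzero coefficient. Zero coefficients beyond it
    -- are discarded, so the degree is only bounded by `n`. This prepares division by arbitrary
    -- nonzero polynomials.
    zero⊎monic : ∀ {u n x} → Poly k u n x →
      x ≈ 0# ⊎ (∃[ d ] ∃[ m ] ∃[ e ] d ℕ.< n × k e × HasValue m e × Monic k u d (e * x))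
    zero⊎monic (nil x≈0) = inj₁ x≈0
    zero⊎monic {u} {x = x} (cons {b = b} {y} ∈b p e) with zero⊎monic p
    ... | inj₂ (d , m , a , d<n , ∈a , va , M) = inj₂ (suc d , m , a , ℕ.s≤s d<n , ∈a , va ,
          cons (∈-* ∈a ∈b) M (R.trans (R.*-congˡ e)
            (solve 4 (λ a b u y → a :* (b :+ u :* y) := a :* b :+ u :* (a :* y)) R.refl a b u y)))
    ... | inj₁ y≈0 with zero⊎value b
    ... | inj₁ b≈0 = inj₁ (R.trans e (R.trans (R.+-cong b≈0 (R.*-congˡ y≈0))
            (solve 1 (λ u → con 0ℤ :+ u :* con 0ℤ := con 0ℤ) R.refl u)))
    ... | inj₂ (n , vb) with ∈-inverse ∈b vb
    ... | a , ∈a , ba≈1 = inj₂ (0 , ℤ.- n , a , ℕ.s≤s ℕ.z≤n , ∈a , value-inverse vb ba≈1 , one (begin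
      a * x             ≈⟨ R.*-congˡ (R.trans e (R.+-congˡ (R.*-congˡ y≈0))) ⟩
      a * (b + u * 0#)  ≈⟨ solve 3 (λ a b u → a :* (b :+ u :* con 0ℤ) := b :* a) R.refl a b u ⟩
      b * a             ≈⟨ ba≈1 ⟩
      1#                ∎))

    -- A monic relation with coefficients in k, divided by its coefficient of least value
    -- (the last one, if there are several), becomes monic modulo 𝔪.
    monic-normalise : ∀ {u d x} → 𝒪 u → Monic k u d x →
      ∃[ m ] ∃[ e ] ∃[ n ] ∃[ z ] k e × HasValue m e × Monic (λ y → k y × 𝒪 y) u n z × e * x ≋ z
    monic-normalise o (one {x = x} x≈1) = 0ℤ , 1# , 0 , 1# , ∈-1 , v-1 , one R.refl ,
      ≋-reflexive (R.trans (R.*-identityˡ x) x≈1)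
    monic-normalise {u} o (cons {x = x} {b} {y} ∈b M e) with monic-normalise o M
    ... | m , a , n , z , ∈a , va , M′ , ay≋z = split (integral? (a * b))
      where
      Result = ∃[ m ] ∃[ e ] ∃[ n ] ∃[ z ] k e × HasValue m e × Monic (λ y → k y × 𝒪 y) u n z × e * x ≋ z
      integral? : ∀ w → 𝒪 w ⊎ (∃[ l ] HasValue -[1+ l ] w)
      integral? w with v w
      ... | ⊤⁺           = inj₁ (_ ≤⊤⁺)
      ... | [ + l ]      = inj₁ [ ℤ.+≤+ ℕ.z≤n ]
      ... | [ -[1+ l ] ] = inj₂ (l , ≡.refl)
      𝒪-ay : 𝒪 (a * y)
      𝒪-ay = 𝒪-≋ ay≋z (monic⊆ 𝒪-isSubring proj₂ o M′)
      split : 𝒪 (a * b) ⊎ (∃[ l ] HasValue -[1+ l ] (a * b)) → Result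
      split (inj₁ oab) = m , a , suc n , a * b + u * z , ∈a , va , cons (∈-* ∈a ∈b , oab) M′ R.refl ,
        ≋-trans (≋-reflexive (R.trans (R.*-congˡ e)
          (solve 4 (λ a b u y → a :* (b :+ u :* y) := a :* b :+ u :* (a :* y)) R.refl a b u y)))
          (≋-+ ≋-refl (≋-*ˡ o ay≋z))
      -- The constant coefficient `a * b` has negative value. Multiplying by its inverse `f` turns
      -- it into `1` and sends `a * y` into `𝔪`, so the normalised relation restarts in degree 0.
      split (inj₂ (l , vab)) with ∈-inverse (∈-* ∈a ∈b) vab
      ... | f , ∈f , abf≈1 = _ , f * a , 0 , 1# , ∈-* ∈f ∈a , value-* vf va , one R.refl ,
        bound-cong (R.sym eq) (𝔪-*ˡ o (𝔪-*ʳ (bound-≤ (ℤ.+≤+ (ℕ.s≤s ℕ.z≤n)) (value⇒bound vf)) 𝒪-ay))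
        where
        vf : HasValue (+ suc l) f
        vf = value-inverse vab abf≈1
        eq : f * a * x - 1# ≈ u * (f * (a * y))
        eq = begin
          f * a * x - 1#                       ≈⟨ R.+-cong (R.*-congˡ e) (R.-‿cong (R.sym abf≈1)) ⟩
          f * a * (b + u * y) - a * b * f      ≈⟨ solve 5 (λ a b f u y →
             f :* a :* (b :+ u :* y) :- a :* b :* f := u :* (f :* (a :* y))) R.refl a b f u y ⟩
          u * (f * (a * y))                    ∎

    -- If all nonzero coefficients have value 0, the first of them alone determines the value of
    -- `x`: it is the exponent of the power of `π` attached to it. Hence a relation with `x = 0#`
    -- forces a coefficient of nonzero value.
    nontrivial⊎finite : ∀ {π d x} → HasValue 1ℤ π → Monic k π d x →
      (∃[ b ] ∃[ n ] k b × HasValue n b × ¬ n ≡ 0ℤ) ⊎ (∃[ j ] HasValue (+ j) x)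
    nontrivial⊎finite vπ (one x≈1) = inj₂ (0 , value-cong (R.sym x≈1) v-1)
    nontrivial⊎finite {π} vπ (cons {x = x} {b} {y} ∈b M e) with nontrivial⊎finite vπ M
    ... | inj₁ found = inj₁ found
    ... | inj₂ (j , vy) with zero⊎value b
    ... | inj₁ b≈0 = inj₂ (suc j , value-cong
      (R.sym (R.trans e (R.trans (R.+-congʳ b≈0) (R.+-identityˡ _)))) (value-* vπ vy))
    ... | inj₂ (n , vb) with n ℤ.≟ 0ℤ
    ... | no n≢0 = inj₁ (b , n , ∈b , vb , n≢0)
    ... | yes ≡.refl = inj₂ (0 , isosceles vb (bound-neg-sym (𝔪-*ʳ (value⇒bound vπ) (𝒪-y))))
      where
      𝒪-y : 𝒪 y
      𝒪-y = bound-≤ (ℤ.+≤+ ℕ.z≤n) (value⇒bound vy)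
      bound-neg-sym : 𝔪 (π * y) → 𝔪 (b - x)
      bound-neg-sym q = bound-cong (R.trans (solve 2 (λ b z → :- z := b :- (b :+ z)) R.refl b (π * y))
        (R.+-congˡ (R.-‿cong (R.sym e)))) (bound-neg q)

-- Squares and sums of two squares modulo the maximal ideal.

module TwoSquares {c ℓ₁ ℓ₂ : Level} (K : HeytingField c ℓ₁ ℓ₂) (𝔭 : FinitePlace K) where
  open HeytingField K
  open FinitePlace 𝔭
  open Completion K 𝔭
  open Place K 𝔭
  open Residue K 𝔭
  private module R = CommutativeRing (commutativeRing K)
  open IntegerCoefficients (commutativeRing K)
  open Polynomials (commutativeRing K)
  open Exp R.semiring using (_^_; ^-homo-*)
  open import Relation.Binary.Reasoning.Setoid R.setoid

  Fraction : ∀ {p} → (Carrier → Set p) → Carrier → Set (c ⊔ ℓ₁ ⊔ p)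
  Fraction A x = ∃[ a ] ∃[ b ] ∃[ n ] A a × A b × HasValue n b × x * b ≈ a

  module _ {p} {A : Carrier → Set p} (isSubring : IsSubring A) where
    open IsSubring isSubring

    ⊆fraction : ∀ {x} → A x → Fraction A x
    ⊆fraction {x} ∈x = x , 1# , 0ℤ , ∈x , ∈-1 , v-1 , R.*-identityʳ x

    fraction-isSubfield : IsSubfield (Fraction A)
    fraction-isSubfield = record
      { isSubring = record
        { resp  = λ { x≈y (a , b , n , ∈a , ∈b , vb , e) →
            a , b , n , ∈a , ∈b , vb , R.trans (R.*-congʳ (R.sym x≈y)) e }
        ; ∈-1   = ⊆fraction ∈-1
        ; ∈-+   = λ { {x} {y} (a , b , _ , ∈a , ∈b , vb , e) (a′ , b′ , _ , ∈a′ , ∈b′ , vb′ , e′) →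
            a * b′ + a′ * b , b * b′ , _ , ∈-+ (∈-* ∈a ∈b′) (∈-* ∈a′ ∈b) , ∈-* ∈b ∈b′ , value-* vb vb′ ,
            R.trans (solve 4 (λ x y b b′ → (x :+ y) :* (b :* b′) := x :* b :* b′ :+ y :* b′ :* b) R.refl x y b b′)
                    (R.+-cong (R.*-congʳ e) (R.*-congʳ e′)) }
        ; ∈-*   = λ { {x} {y} (a , b , _ , ∈a , ∈b , vb , e) (a′ , b′ , _ , ∈a′ , ∈b′ , vb′ , e′) →
            a * a′ , b * b′ , _ , ∈-* ∈a ∈a′ , ∈-* ∈b ∈b′ , value-* vb vb′ ,
            R.trans (solve 4 (λ x y b b′ → (x :* y) :* (b :* b′) := (x :* b) :* (y :* b′)) R.refl x y b b′)
                    (R.*-cong e e′) }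
        ; ∈-neg = λ { {x} (a , b , _ , ∈a , ∈b , vb , e) →
            - a , b , _ , ∈-neg ∈a , ∈b , vb ,
            R.trans (solve 2 (λ x b → (:- x) :* b := :- (x :* b)) R.refl x b) (R.-‿cong e) }
        }
      ; ∈-inverse = λ { {x = x} (a , b , _ , ∈a , ∈b , vb , e) vx →
          let y , xy≈1 = inverse vx
          in y , (b , a , _ , ∈b , ∈a , value-cong e (value-* vx vb) , (begin
            y * a         ≈⟨ R.*-congˡ (R.sym e) ⟩
            y * (x * b)   ≈⟨ solve 3 (λ x y b → y :* (x :* b) := x :* y :* b) R.refl x y b ⟩
            x * y * b     ≈⟨ R.*-congʳ xy≈1 ⟩
            1# * b        ≈⟨ R.*-identityˡ b ⟩
            b             ∎)) , xy≈1 }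
      }

  -- K is a finite extension of the fraction field of a Euclidean domain A ⊆ 𝒪, whose
  -- elements of size at most n are finitely many modulo 𝔪.
  record EuclideanBase (p : Level) : Set (c ⊔ ℓ₁ ⊔ Level.suc p) where
    field
      Size      : ℕ → Carrier → Set p
      isSubring : IsSubring (λ x → ∃[ n ] Size n x)
      integral  : ∀ {n x} → Size n x → 𝒪 x
      size-0    : ∀ {x} → Size 0 x → x ≈ 0#
      divide    : ∀ {m n a b} → Size m a → Size (suc n) b → b ≈ 0# ⊎
                  (∃[ q ] ∃[ r ] (∃[ l ] Size l q) × Size n r × a ≈ q * b + r)
      covered   : ∀ n → Covered (Size n)
      degree    : ℕ
      basis     : Vector Carrier degree
      spanning  : ∀ x → Span (Fraction (λ y → ∃[ n ] Size n y)) basis x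

  IsSquareMod SumOfTwoSquares : Carrier → Set c
  IsSquareMod u     = ∃[ t ] 𝒪 t × u ≋ t * t
  SumOfTwoSquares u = ∃[ x ] ∃[ y ] 𝒪 x × 𝒪 y × u ≋ x * x + y * y

  -- Here `h` is one half. The sign is kept as a factor `- 1#`, to be replaced by a square or by a
  -- sum of two squares.
  differenceOfSquares : ∀ a h → (1# + 1#) * h ≈ 1# →
    a ≈ (a + 1#) * h * ((a + 1#) * h) + (a - 1#) * h * ((a - 1#) * h) * - 1#
  differenceOfSquares a h 2h≈1 = begin
    a                                            ≈⟨ solve 1 (λ a → a := a :* (con 1ℤ :* con 1ℤ)) R.refl a ⟩
    a * (1# * 1#)                                ≈⟨ R.*-congˡ (R.*-cong (R.sym 2h≈1) (R.sym 2h≈1)) ⟩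
    a * ((1# + 1#) * h * ((1# + 1#) * h))        ≈⟨ solve 2 (λ a h →
       a :* (con (+ 2) :* h :* (con (+ 2) :* h)) :=
       (a :+ con 1ℤ) :* h :* ((a :+ con 1ℤ) :* h) :+ (a :- con 1ℤ) :* h :* ((a :- con 1ℤ) :* h) :* (:- con 1ℤ)) R.refl a h ⟩
    (a + 1#) * h * ((a + 1#) * h) + (a - 1#) * h * ((a - 1#) * h) * - 1#  ∎

  parity : ∀ n → ∃[ k ] (n ≡ k ℕ.+ k ⊎ n ≡ suc (k ℕ.+ k))
  parity zero = 0 , inj₁ ≡.refl
  parity (suc n) with parity n
  ... | k , inj₁ e = k , inj₂ (≡.cong suc e)
  ... | k , inj₂ e = suc k , inj₁ (≡.trans (≡.cong suc e) (≡.cong suc (≡.sym (ℕ.+-suc k k))))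

  -- Take the least power of u of order 2^s.  If s = 0 then u is a square; otherwise its
  -- 2^(s−1)-th power is −1, which is a square if s > 1 and u times a square if s = 1.
  torsion⇒square : ∀ {u} N → Unit u → u ^ suc N ≋ 1# →
    IsSquareMod u ⊎ IsSquareMod (- 1#) ⊎ (∃[ t ] 𝒪 t × - 1# ≋ u * (t * t))
  torsion⇒square {u} N unit = ℕ.<-rec _ go N
    where
    ou = value⇒bound unit
    Result = IsSquareMod u ⊎ IsSquareMod (- 1#) ⊎ (∃[ t ] 𝒪 t × - 1# ≋ u * (t * t))
    go : ∀ N → (∀ {k} → k ℕ.< N → u ^ suc k ≋ 1# → Result) → u ^ suc N ≋ 1# → Result
    go N rec e with parity N
    -- The exponent is `suc N`, so even `N` is the case of an odd exponent `2k + 1`, and `u` is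
    -- congruent to `u ^ (2k + 2)`, a square.
    ... | k , inj₁ ≡.refl = inj₁ (u ^ suc k , 𝒪-^ ou (suc k) , ≋-trans
      (≋-reflexive (R.sym (R.*-identityʳ u))) (≋-trans (≋-*ˡ ou (≋-sym e)) (≋-reflexive
        (R.trans (R.*-congˡ (R.*-congˡ (^-homo-* u k k)))
          (solve 2 (λ u w → u :* (u :* (w :* w)) := u :* w :* (u :* w)) R.refl u (u ^ k))))))
    ... | k , inj₂ ≡.refl = halve (𝔪-prime (bound-- ow 𝒪-1) (bound-cong eq e))
      where
      w = u ^ suc k
      ow = 𝒪-^ ou (suc k)
      eq : u ^ suc (suc (k ℕ.+ k)) - 1# ≈ (w - 1#) * (w + 1#)
      eq = R.trans (R.+-congʳ (R.*-congˡ (R.*-congˡ (^-homo-* u k k))))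
        (solve 2 (λ u z → u :* (u :* (z :* z)) :- con 1ℤ := (u :* z :- con 1ℤ) :* (u :* z :+ con 1ℤ)) R.refl u (u ^ k))
      halve : 𝔪 (w - 1#) ⊎ 𝔪 (w + 1#) → Result
      halve (inj₁ w≋1) = rec (ℕ.s≤s (ℕ.m≤m+n k k)) w≋1
      -- Now `w = u ^ (k + 1)` is congruent to -1: for even `k` it is `u` times a square, for odd
      -- `k` a square.
      halve (inj₂ w≋-1) with parity k
      ... | l , inj₁ ≡.refl = inj₂ (inj₂ (u ^ l , 𝒪-^ ou l ,
        ≋-trans -1≋w (≋-reflexive (R.*-congˡ (^-homo-* u l l)))))
        where
        -1≋w : - 1# ≋ w
        -1≋w = bound-cong (solve 1 (λ w → :- (w :+ con 1ℤ) := (:- con 1ℤ) :- w) R.refl w) (bound-neg w≋-1)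
      ... | l , inj₂ ≡.refl = inj₂ (inj₁ (u ^ suc l , 𝒪-^ ou (suc l) ,
        ≋-trans (bound-cong (solve 1 (λ w → :- (w :+ con 1ℤ) := (:- con 1ℤ) :- w) R.refl w) (bound-neg w≋-1))
          (≋-reflexive (R.trans (R.*-congˡ (R.*-congˡ (^-homo-* u l l)))
            (solve 2 (λ u z → u :* (u :* (z :* z)) := u :* z :* (u :* z)) R.refl u (u ^ l))))))

  -- Residue classes over a Euclidean base.

  module _ {p} (base : EuclideanBase p) where
    open EuclideanBase base
    open IsSubring isSubring

    private
      A k : Carrier → Set _
      A x = ∃[ n ] Size n x
      k = Fraction A

      A⊆𝒪 : ∀ {x} → A x → 𝒪 x
      A⊆𝒪 (_ , s) = integral s

      k-isSubfield : IsSubfield k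
      k-isSubfield = fraction-isSubfield isSubring

    -- A quotient of two units has value 0, so the numerator or the denominator lies in `𝔪`.
    value≢0⇒A∩𝔪 : ∀ {n a b} → A a → A b → HasValue n b → ∀ {m x} → HasValue m x → ¬ m ≡ 0ℤ →
                      x * b ≈ a → ∃[ y ] ∃[ j ] A y × HasValue j y × 𝔪 y
    value≢0⇒A∩𝔪 {n} {a} {b} ∈a ∈b vb {m} {x} vx m≢0 e with unit⊎𝔪 (A⊆𝒪 ∈a) | unit⊎𝔪 (A⊆𝒪 ∈b)
    ... | inj₂ 𝔪a | _       = a , _ , ∈a , value-cong e (value-* vx vb) , 𝔪a
    ... | inj₁ _  | inj₂ 𝔪b = b , _ , ∈b , vb , 𝔪b
    ... | inj₁ ua | inj₁ ub = contradiction
      (≡.trans (≡.sym (ℤ.+-identityʳ m)) (value-unique (value-* vx ub) (value-cong (R.sym e) ua))) m≢0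

    -- A uniformiser `π` is algebraic over `k`. Its relation evaluates to `0#`, which has no finite
    -- value, so some coefficient in `k` has nonzero value.
    A∩𝔪-nontrivial : ∃[ y ] ∃[ j ] A y × HasValue j y × 𝔪 y
    A∩𝔪-nontrivial =
      let π , vπ = surjective 1ℤ
          d , M  = algebraic k-isSubfield basis spanning π
      in split (nontrivial⊎finite k-isSubfield vπ M)
      where
      split : (∃[ x ] ∃[ n ] k x × HasValue n x × ¬ n ≡ 0ℤ) ⊎ (∃[ j ] HasValue (+ j) 0#) →
              ∃[ y ] ∃[ j ] A y × HasValue j y × 𝔪 y
      split (inj₁ (x , n , (a , b , _ , ∈a , ∈b , vb , e) , vx , n≢0)) = value≢0⇒A∩𝔪 ∈a ∈b vb vx n≢0 e
      split (inj₂ (j , v0)) = contradiction R.refl (value⇒≉0 v0)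

    -- Division by a fixed nonzero element of `A` in `𝔪` replaces any element of `A` by a congruent
    -- remainder of bounded size.
    A-covered : Covered A
    A-covered =
      let m , j , (n , s) , vm , 𝔪m = A∩𝔪-nontrivial
      in cover n s vm 𝔪m
      where
      cover : ∀ n {m j} → Size n m → HasValue j m → 𝔪 m → Covered A
      cover zero    s vm 𝔪m = contradiction (size-0 s) (value⇒≉0 vm)
      cover (suc n) {m} s vm 𝔪m = covered-⊆ reduce (covered n)
        where
        reduce : ∀ {x} → A x → ∃[ r ] Size n r × x ≋ r
        reduce {x} (l , t) with divide t s
        ... | inj₁ m≈0 = contradiction m≈0 (value⇒≉0 vm)
        ... | inj₂ (q , r , ∈q , sr , e) = r , sr , bound-cong
          (R.trans (solve 2 (λ z r → z := z :+ r :- r) R.refl (q * m) r) (R.+-congʳ (R.sym e)))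
          (𝔪-*ˡ (A⊆𝒪 ∈q) 𝔪m)

    -- The Euclidean algorithm, recording of the cofactors only that one of them is a unit at the
    -- place. This passes from `(b′ , r′)` to `(q * b′ + r′ , b′)`: if `b′` lies in `𝔪` and `r′` is
    -- a unit, so is `q * b′ + r′`.
    euclid : ∀ n {a b} → A a → Size n b →
      ∃[ g ] ∃[ a′ ] ∃[ b′ ] A a′ × A b′ × a ≈ g * a′ × b ≈ g * b′ × (Unit a′ ⊎ Unit b′)
    euclid zero {a} {b} ∈a sb = a , 1# , 0# , ∈-1 , ∈-0 , R.sym (R.*-identityʳ a) ,
      R.trans (size-0 sb) (R.sym (R.zeroʳ a)) , inj₁ v-1
    euclid (suc n) {a} {b} (l , sa) sb with divide sa sb
    ... | inj₁ b≈0 = a , 1# , 0# , ∈-1 , ∈-0 , R.sym (R.*-identityʳ a) ,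
      R.trans b≈0 (R.sym (R.zeroʳ a)) , inj₁ v-1
    ... | inj₂ (q , r , ∈q , sr , e) with euclid n (_ , sb) sr
    ... | g , b′ , r′ , ∈b′ , ∈r′ , eb , er , units =
      g , q * b′ + r′ , b′ , ∈-+ (∈-* ∈q ∈b′) ∈r′ , ∈b′ , (begin
        a                          ≈⟨ R.trans e (R.+-cong (R.*-congˡ eb) er) ⟩
        q * (g * b′) + g * r′      ≈⟨ solve 4 (λ q g b r → q :* (g :* b) :+ g :* r := g :* (q :* b :+ r)) R.refl q g b′ r′ ⟩
        g * (q * b′ + r′)          ∎) , eb , units′ units
      where
      units′ : Unit b′ ⊎ Unit r′ → Unit (q * b′ + r′) ⊎ Unit b′
      units′ (inj₁ ub) = inj₂ ub
      units′ (inj₂ ur) with unit⊎𝔪 (A⊆𝒪 ∈b′)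
      ... | inj₁ ub = inj₂ ub
      ... | inj₂ mb = inj₁ (isosceles ur (bound-cong
        (solve 2 (λ z r → :- z := r :- (z :+ r)) R.refl (q * b′) r′) (bound-neg (𝔪-*ˡ (A⊆𝒪 ∈q) mb))))

    A-torsion : ∀ {u} → A u → Unit u → ∃[ N ] u ^ suc N ≋ 1#
    A-torsion ∈u = unit⇒torsion A-covered (∈-^ ∈u)

    -- After cancelling `g`, a denominator `b′` in `𝔪` would put `a′ = x b′` in `𝔪` as well, whereas
    -- one of the two is a unit.
    integralFraction : ∀ {x} → k x → 𝒪 x → ∃[ a ] ∃[ b ] A a × A b × Unit b × x * b ≈ a
    integralFraction {x} (a , b , n , ∈a , (m , sb) , vb , e) ox with euclid m ∈a sb
    ... | g , a′ , b′ , ∈a′ , ∈b′ , ea , eb , units = a′ , b′ , ∈a′ , ∈b′ , unit-b′ units , xb′≈a′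
      where
      vg : ∃[ j ] HasValue j g
      vg with zero⊎value g
      ... | inj₁ g≈0 = contradiction (R.trans eb (R.trans (R.*-congʳ g≈0) (R.zeroˡ b′))) (value⇒≉0 vb)
      ... | inj₂ v   = v
      xb′≈a′ : x * b′ ≈ a′
      xb′≈a′ = *-cancelˡ (proj₂ vg) (begin
        g * (x * b′)  ≈⟨ solve 3 (λ g x b → g :* (x :* b) := x :* (g :* b)) R.refl g x b′ ⟩
        x * (g * b′)  ≈⟨ R.*-congˡ (R.sym eb) ⟩
        x * b         ≈⟨ R.trans e ea ⟩
        g * a′        ∎)
      unit-b′ : Unit a′ ⊎ Unit b′ → Unit b′
      unit-b′ (inj₂ ub) = ub
      unit-b′ (inj₁ ua) with unit⊎𝔪 (A⊆𝒪 ∈b′)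
      ... | inj₁ ub = ub
      ... | inj₂ mb = contradiction (bound-cong xb′≈a′ (𝔪-*ˡ ox mb)) (unit⇒∉𝔪 ua)

    -- The denominator is a unit of finite order modulo `𝔪`, so one of its powers inverts it there
    -- and every class has a representative in `A`.
    k∩𝒪-covered : Covered (λ x → k x × 𝒪 x)
    k∩𝒪-covered = covered-⊆ represent A-covered
      where
      represent : ∀ {x} → k x × 𝒪 x → ∃[ y ] A y × x ≋ y
      represent {x} (kx , ox) =
        let a , b , ∈a , ∈b , ub , xb≈a = integralFraction kx ox
            N , bᴺ≋1 = A-torsion ∈b ub
        in a * b ^ N , ∈-* ∈a (∈-^ ∈b N) , ≋-trans
          (≋-trans (≋-reflexive (R.sym (R.*-identityʳ x))) (≋-*ˡ ox (≋-sym bᴺ≋1)))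
          (≋-reflexive (R.trans (solve 3 (λ x b c → x :* (b :* c) := x :* b :* c) R.refl x b (b ^ N)) (R.*-congʳ xb≈a)))

    -- Division by a relation for `u` that is monic modulo `𝔪` brings every power of `u` down to `n`
    -- coefficients in `k ∩ 𝒪`, hence to finitely many classes.
    residue-torsion : ∀ {u} → Unit u → ∃[ N ] u ^ suc N ≋ 1#
    residue-torsion {u} unit =
      let d , M = algebraic k-isSubfield basis spanning u
          m , e , n , z , ∈e , ve , M′ , e0≋z = monic-normalise k-isSubfield ou M
          -- The relation has value `0#`, so its normalised form `z` is congruent to `e * 0#`.
          𝔪z = bound-cong (solve 2 (λ e z → z :- e :* con 0ℤ := z) R.refl e z) (≋-sym e0≋z)
      in unit⇒torsion {P = λ x → ∃[ l ] Poly (λ y → k y × 𝒪 y) u l x}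
           (covered-⊆ (λ { (l , P) → reduce M′ 𝔪z P }) (covered-poly ou k∩𝒪-covered n))
           (λ l → suc l , poly-^ S u l) unit
      where
      ou = value⇒bound unit
      S = ∩𝒪-isSubring (IsSubfield.isSubring k-isSubfield)
      reduce : ∀ {n z l x} → Monic (λ y → k y × 𝒪 y) u n z → 𝔪 z → Poly (λ y → k y × 𝒪 y) u l x →
               ∃[ r ] Poly (λ y → k y × 𝒪 y) u n r × x ≋ r
      reduce {z = z} M 𝔪z P =
        let q , r , Q , P′ , e = division S u M P
        in r , P′ , bound-cong
          (R.trans (solve 2 (λ z r → z := z :+ r :- r) R.refl (q * z) r) (R.+-congʳ (R.sym e)))
          (𝔪-*ˡ (poly⊆ 𝒪-isSubring proj₂ ou Q) 𝔪z)

    -- By the pigeonhole principle some positive integer lies in `𝔪`. Either the walk finds two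
    -- squares before reaching it, or its predecessor is a square modulo `𝔪`; that predecessor is
    -- congruent to -1.
    minusOne-twoSquares : SumOfTwoSquares (- 1#)
    minusOne-twoSquares =
      let i , k , eq = pigeonhole (λ x≋z y≋z → ≋-trans x≋z (≋-sym y≋z)) A-covered natural natural∈A
      in finish k (bound-cong (cancel i (suc k)) (≋-sym eq))
      where
      natural : ℕ → Carrier
      natural zero    = 0#
      natural (suc n) = 1# + natural n

      natural∈A : ∀ n → A (natural n)
      natural∈A zero    = ∈-0
      natural∈A (suc n) = ∈-+ ∈-1 (natural∈A n)

      cancel : ∀ i k → natural (k ℕ.+ i) - natural i ≈ natural k
      cancel i zero    = R.-‿inverseʳ (natural i)
      cancel i (suc k) = R.trans (R.+-assoc 1# _ _) (R.+-congˡ (cancel i k))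

      fromSquare : ∀ {t} → 𝒪 t → - 1# ≋ t * t → SumOfTwoSquares (- 1#)
      fromSquare {t} ot e = t , 0# , ot , bound-0 R.refl ,
        ≋-trans e (≋-reflexive (solve 1 (λ t → t :* t := t :* t :+ con 0ℤ :* con 0ℤ) R.refl t))

      negate : ∀ {x t} → x ≋ t * t → 𝔪 (1# + x) → - 1# ≋ t * t
      negate {x} x≋t² 1+x = ≋-trans (bound-cong
        (solve 1 (λ x → :- (con 1ℤ :+ x) := (:- con 1ℤ) :- x) R.refl x) (bound-neg 1+x)) x≋t²

      -- The first of 1, 2, 3, … that is not a square modulo 𝔪 is 1 + t².
      walk : ∀ n → IsSquareMod (natural (suc n)) ⊎ SumOfTwoSquares (- 1#)
      walk zero = inj₁ (1# , 𝒪-1 , ≋-reflexive (solve 0 (con 1ℤ :+ con 0ℤ := con 1ℤ :* con 1ℤ) R.refl))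
      walk (suc n) = step (walk n)
        where
        w = natural (suc (suc n))
        next : ∀ {t} → 𝒪 t → natural (suc n) ≋ t * t → Unit w ⊎ 𝔪 w →
               IsSquareMod w ⊎ SumOfTwoSquares (- 1#)
        next ot e (inj₂ 𝔪w) = inj₂ (fromSquare ot (negate e 𝔪w))
        next {t} ot e (inj₁ uw) = conclude
            (torsion⇒square (proj₁ (residue-torsion uw)) uw (proj₂ (residue-torsion uw)))
          where
          conclude : IsSquareMod w ⊎ IsSquareMod (- 1#) ⊎ (∃[ s ] 𝒪 s × - 1# ≋ w * (s * s)) →
                     IsSquareMod w ⊎ SumOfTwoSquares (- 1#)
          conclude (inj₁ sq) = inj₁ sq
          conclude (inj₂ (inj₁ (s , os , e′))) = inj₂ (fromSquare os e′)
          -- Since `w ≋ 1 + t²`, the congruence `−1 ≋ w s²` reads `−1 ≋ s² + (t s)²`.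
          conclude (inj₂ (inj₂ (s , os , e′))) = inj₂ (s , t * s , os , bound-* ot os ,
            ≋-trans e′ (≋-trans (≋-* (value⇒bound uw) (bound-* os os) (≋-+ ≋-refl e) ≋-refl)
              (≋-reflexive (solve 2 (λ s t → (con 1ℤ :+ t :* t) :* (s :* s) := s :* s :+ t :* s :* (t :* s)) R.refl s t))))
        step : IsSquareMod (natural (suc n)) ⊎ SumOfTwoSquares (- 1#) →
               IsSquareMod w ⊎ SumOfTwoSquares (- 1#)
        step (inj₂ found) = inj₂ found
        step (inj₁ (t , ot , e)) = next ot e (unit⊎𝔪 (A⊆𝒪 (natural∈A (suc (suc n)))))

      finish : ∀ k → 𝔪 (natural (suc k)) → SumOfTwoSquares (- 1#)
      finish zero    𝔪1 = contradiction (bound-cong (R.+-identityʳ 1#) 𝔪1) (unit⇒∉𝔪 v-1)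
      finish (suc k) 𝔪s with walk k
      ... | inj₂ found        = found
      ... | inj₁ (t , ot , e) = fromSquare ot (negate e 𝔪s)

    -- The three outcomes of `torsion⇒square`: a square needs a second summand 0; a root of -1 turns
    -- the difference of squares for `u` into a sum; otherwise `u` is -1 times a square, and -1 is a
    -- sum of two squares.
    unit-twoSquares : Unit (1# + 1#) → ∀ {u} → Unit u → SumOfTwoSquares u
    unit-twoSquares u2 {u} uu =
      let N , e = residue-torsion uu in conclude (torsion⇒square N uu e)
      where
      ou = value⇒bound uu
      conclude : IsSquareMod u ⊎ IsSquareMod (- 1#) ⊎ (∃[ s ] 𝒪 s × - 1# ≋ u * (s * s)) → SumOfTwoSquares u
      conclude (inj₁ (t , ot , e)) = t , 0# , ot , bound-0 R.refl ,
        ≋-trans e (≋-reflexive (solve 1 (λ t → t :* t := t :* t :+ con 0ℤ :* con 0ℤ) R.refl t))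
      conclude (inj₂ (inj₁ (t , ot , e))) =
        let h , 2h≈1 = inverse u2
            oh = value⇒bound (value-inverse u2 2h≈1)
            x = (u + 1#) * h
            y = (u - 1#) * h
            oy = bound-* (bound-- ou 𝒪-1) oh
        in x , y * t , bound-* (bound-+ ou 𝒪-1) oh , bound-* oy ot ,
          ≋-trans (≋-reflexive (differenceOfSquares u h 2h≈1))
            (≋-trans (≋-+ ≋-refl (≋-*ˡ (bound-* oy oy) e))
              (≋-reflexive (solve 3 (λ x y t → x :* x :+ y :* y :* (t :* t) := x :* x :+ y :* t :* (y :* t)) R.refl x y t)))
      conclude (inj₂ (inj₂ (t , ot , e))) =
        let x , y , ox , oy , e′ = minusOne-twoSquares
            ut = u * t
            out = bound-* ou ot
        in ut * x , ut * y , bound-* out ox , bound-* out oy ,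
          -- u = (−u)(−1) ≋ (−u)(u t²) = (u t)² (−1)
          ≋-trans (≋-reflexive (solve 1 (λ u → u := (:- u) :* (:- con 1ℤ)) R.refl u))
            (≋-trans (≋-*ˡ (bound-neg ou) e)
            (≋-trans (≋-reflexive (solve 2 (λ u t → (:- u) :* (u :* (t :* t)) := u :* t :* (u :* t) :* (:- con 1ℤ)) R.refl u t))
            (≋-trans (≋-*ˡ (bound-* out out) e′)
              (≋-reflexive (solve 3 (λ w x y → w :* w :* (x :* x :+ y :* y) := w :* x :* (w :* x) :+ w :* y :* (w :* y)) R.refl ut x y)))))

-- Sums of squares in the completion.

module Lengths {c ℓ₁ ℓ₂ : Level} (K : HeytingField c ℓ₁ ℓ₂) (𝔭 : FinitePlace K) where
  open HeytingField K
  open FinitePlace 𝔭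
  open Completion K 𝔭
  open Place K 𝔭
  open TwoSquares K 𝔭
  open SumsOfSquares completion
  private module R = CommutativeRing (commutativeRing K)
  open IntegerCoefficients (commutativeRing K)
  open import Relation.Binary.Reasoning.Setoid R.setoid

  -- Hensel's lemma for square roots.

  module Hensel (u2 : Unit (1# + 1#)) {b x₀ : Carrier} (ux₀ : Unit x₀) (x₀²≋b : x₀ * x₀ ≋ b) where
    -- A unit root modulo the power `n + 1` of `𝔪`, so that index 0 is the given congruence for
    -- `x₀`.
    Approximation : ℕ → Set c
    Approximation n = ∃[ x ] Unit x × [ + suc n ] ≤⁺ v (x * x - b)

    -- One Newton step `x − d h` with `d = x² − b` and `h = 1 / (2 x)`. The new error is `(d h)²`,
    -- of value at least `2n + 2`, of which `n + 2` is kept; the bound on the change makes the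
    -- iterates Cauchy.
    newton : ∀ {n} → ((x , _) : Approximation n) →
             Σ[ (y , _) ∈ Approximation (suc n) ] [ + suc n ] ≤⁺ v (y - x)
    newton {n} (x , ux , p) =
      let h , 2xh≈1 = inverse (value-* u2 ux)
          oh = value⇒bound (value-inverse (value-* u2 ux) 2xh≈1)
          d  = x * x - b
          dh = bound-≤ (ℤ.≤-reflexive (≡.sym (ℤ.+-identityʳ (+ suc n)))) (bound-* p oh)
      in ( x - d * h
         , isosceles ux (bound-cong (solve 2 (λ x e → e := x :- (x :- e)) R.refl x (d * h))
             (bound-≤ (ℤ.+≤+ (ℕ.s≤s ℕ.z≤n)) dh))
         , bound-cong (R.sym (square x b h 2xh≈1))
             (bound-≤ (ℤ.+≤+ (ℕ.s≤s (ℕ.m≤n+m (suc n) n))) (bound-* dh dh)))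
         , bound-cong (solve 2 (λ x e → :- e := x :- e :- x) R.refl x (d * h)) (bound-neg dh)
      where
      square : ∀ x b h → (1# + 1#) * x * h ≈ 1# →
        (x - (x * x - b) * h) * (x - (x * x - b) * h) - b ≈ (x * x - b) * h * ((x * x - b) * h)
      square x b h 2xh≈1 = begin
        (x - (x * x - b) * h) * (x - (x * x - b) * h) - b
          ≈⟨ solve 3 (λ x b h → let d = x :* x :- b in (x :- d :* h) :* (x :- d :* h) :- b :=
               d :* h :* (d :* h) :+ d :* (con 1ℤ :- con (+ 2) :* x :* h)) R.refl x b h ⟩
        (x * x - b) * h * ((x * x - b) * h) + (x * x - b) * (1# - (1# + 1#) * x * h)
          ≈⟨ R.+-congˡ (R.*-congˡ (R.+-congˡ (R.-‿cong 2xh≈1))) ⟩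
        (x * x - b) * h * ((x * x - b) * h) + (x * x - b) * (1# - 1#)
          ≈⟨ solve 2 (λ e d → e :+ d :* (con 1ℤ :- con 1ℤ) := e) R.refl ((x * x - b) * h * ((x * x - b) * h)) (x * x - b) ⟩
        (x * x - b) * h * ((x * x - b) * h)  ∎

    approximation : ∀ n → Approximation n
    approximation zero    = x₀ , ux₀ , x₀²≋b
    approximation (suc n) = proj₁ (newton (approximation n))

    root : ℕ → Carrier
    root n = proj₁ (approximation n)

    root-step : ∀ n k → [ + suc n ] ≤⁺ v (root (k ℕ.+ n) - root n)
    root-step n zero    = bound-0 (R.-‿inverseʳ (root n))
    root-step n (suc k) = bound-cong
      (solve 3 (λ x y z → (x :- y) :+ (y :- z) := x :- z) R.refl (root (suc k ℕ.+ n)) (root (k ℕ.+ n)) (root n))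
      (bound-+ (bound-≤ (ℤ.+≤+ (ℕ.s≤s (ℕ.m≤n+m n k))) (proj₂ (newton (approximation (k ℕ.+ n)))))
               (root-step n k))

    root-bound : ∀ {n m} → n ℕ.≤ m → [ + suc n ] ≤⁺ v (root m - root n)
    root-bound {n} {m} n≤m = ≡.subst (λ k → [ + suc n ] ≤⁺ v (root k - root n))
      (ℕ.m∸n+n≡m n≤m) (root-step n (m ℕ.∸ n))

    -- Lets `∣ N ∣` serve as the index from which precision `N` holds, for `N` of either sign.
    i≤∣i∣ : ∀ i → i ℤ.≤ + suc ℤ.∣ i ∣
    i≤∣i∣ (+ n)    = ℤ.+≤+ (ℕ.n≤1+n n)
    i≤∣i∣ -[1+ n ] = ℤ.-≤+

    isSquare : IsSquare (ι b)
    isSquare = mk root (λ N → ℤ.∣ N ∣ , λ m n p q → bound-≤ (i≤∣i∣ N) (bound-cong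
        (solve 3 (λ x y z → (x :- z) :- (y :- z) := x :- y) R.refl (root m) (root n) (root ℤ.∣ N ∣))
        (bound-- (root-bound p) (root-bound q)))) ,
      λ N → ℤ.∣ N ∣ , λ n p → bound-≤ (ℤ.≤-trans (i≤∣i∣ N) (ℤ.+≤+ (ℕ.s≤s p))) (bound-cong
        (solve 2 (λ x b → :- (x :* x :- b) := b :- x :* x) R.refl (root n) b)
        (bound-neg (proj₂ (proj₂ (approximation n)))))

  -- The root `s` of `b` lives in the completion, and `d² b` becomes `(d s)²` there: the error is
  -- `d² (b − s²)`, a constant times a null sequence.
  twoSquares : ∀ {a b d y} → IsSquare (ι b) → a ≈ d * d * b + y * y → IsSumOfSquares 2 (ι a)
  twoSquares {a} {b} {d} {y} (s , b≈s²) e = (ι d *̂ s) ∷ ι y ∷ (λ ()) , null-cong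
    (λ n → R.trans (solve 4 (λ b d s y → d :* d :* (b :- s :* s) :=
         (d :* d :* b :+ y :* y) :- (d :* s :* (d :* s) :+ (y :* y :+ con 0ℤ))) R.refl b d (at s n) y)
      (R.+-congʳ (R.sym e)))
    (null-* (cauchy⇒bounded (ι (d * d))) b≈s²)

  threeSquares : ∀ {a b d y z} → IsSquare (ι b) → a ≈ d * d * b + y * y + z * z → IsSumOfSquares 3 (ι a)
  threeSquares {a} {b} {d} {y} {z} (s , b≈s²) e = (ι d *̂ s) ∷ ι y ∷ ι z ∷ (λ ()) , null-cong
    (λ n → R.trans (solve 5 (λ b d s y z → d :* d :* (b :- s :* s) :=
         (d :* d :* b :+ y :* y :+ z :* z) :- (d :* s :* (d :* s) :+ (y :* y :+ (z :* z :+ con 0ℤ)))) R.refl b d (at s n) y z)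
      (R.+-congʳ (R.sym e)))
    (null-* (cauchy⇒bounded (ι (d * d))) b≈s²)

  oneSquare : ∀ {a} → IsSquare (ι a) → IsSumOfSquares 1 (ι a)
  oneSquare {a} (s , a≈s²) = s ∷ (λ ()) , null-cong
    (λ n → solve 2 (λ a s → a :- s :* s := a :- (s :* s :+ con 0ℤ)) R.refl a (at s n)) a≈s²

  oneSquare⇒isSquare : ∀ {a} → IsSumOfSquares 1 (ι a) → IsSquare (ι a)
  oneSquare⇒isSquare {a} (s , a≈s²) = s Fin.zero , null-cong
    (λ n → solve 2 (λ a s → a :- (s :* s :+ con 0ℤ) := a :- s :* s) R.refl a (at (s Fin.zero) n)) a≈s²

  -- Values are locally constant away from zero, so a representation in the completion yields an
  -- element of `K` of the same shape and of the same value as `a`.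
  limit-value : ∀ {n a} {s : ℕ → Carrier} → HasValue n a → IsNull (λ k → a - s k) → ∃[ k ] HasValue n (s k)
  limit-value {n} va null = let M , close = null (ℤ.suc n) in M , isosceles va (close M ℕ.≤-refl)

  ¬zeroSquares : ∀ {n a} → HasValue n a → ¬ IsSumOfSquares 0 (ι a)
  ¬zeroSquares va (_ , a≈0) = value⇒≉0 (proj₂ (limit-value va a≈0)) R.refl

  even-double : ∀ i → Even (i ℤ.+ i)
  even-double i = ℤ∣.divides ℤ.∣ i ∣ (≡.trans
    (≡.cong ℤ.∣_∣ (≡.trans
      (≡.cong₂ ℤ._+_ (≡.sym (ℤ.*-identityʳ i)) (≡.sym (ℤ.*-identityʳ i)))
      (≡.sym (ℤ.*-distribˡ-+ i 1ℤ 1ℤ))))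
    (ℤ.abs-* i (+ 2)))

  k*2≡k+k : ∀ k → k ℕ.* 2 ≡ k ℕ.+ k
  k*2≡k+k k = ≡.trans (ℕ.*-comm k 2) (≡.cong (k ℕ.+_) (ℕ.+-identityʳ k))

  even⇒double : ∀ n → Even n → ∃[ i ] n ≡ i ℤ.+ i
  even⇒double (+ n)    (ℤ∣.divides k e) = + k , ≡.cong +_ (≡.trans e (k*2≡k+k k))
  even⇒double -[1+ n ] (ℤ∣.divides k e) = ℤ.- + k , ≡.trans
    (≡.cong (λ m → ℤ.- + m) (≡.trans e (k*2≡k+k k))) (ℤ.neg-distrib-+ (+ k) (+ k))

  value-square⇒even : ∀ {n x} → HasValue n (x * x) → Even n
  value-square⇒even {x = x} vxx with zero⊎value x
  ... | inj₁ x≈0 = contradiction (R.trans (R.*-congʳ x≈0) (R.zeroˡ x)) (value⇒≉0 vxx)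
  ... | inj₂ (m , vx) = ≡.subst Even (value-unique (value-* vx vx) vxx) (even-double m)

  odd⇒¬isSquare : ∀ {n a} → HasValue n a → Odd n → ¬ IsSquare (ι a)
  odd⇒¬isSquare va odd (s , a≈s²) = odd (value-square⇒even (proj₂ (limit-value va a≈s²)))

  double-mono-< : ∀ {m n} → m ℤ.< n → ℤ.suc (m ℤ.+ m) ℤ.≤ n ℤ.+ n
  double-mono-< m<n = ℤ.i<j⇒suc[i]≤j (ℤ.+-mono-< m<n m<n)

  value-sum-< : ∀ {m l x y} → HasValue m x → HasValue l y → m ℤ.< l → HasValue (m ℤ.+ m) (x * x + y * y)
  value-sum-< {x = x} {y} vx vy m<l = isosceles (value-* vx vx) (bound-cong
    (solve 2 (λ x y → :- y := x :- (x :+ y)) R.refl (x * x) (y * y))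
    (bound-neg (bound-≤ (double-mono-< m<l) (value⇒bound (value-* vy vy)))))

  -- −̂ ι a and ι (− a) are the same sequence with different proofs of convergence.
  isSquare-neg-ι : ∀ {a} → IsSquare (-̂ ι a) → IsSquare (ι (- a))
  isSquare-neg-ι (s , e) = s , null-cong (λ n → R.refl) e

  isSquare-ι-neg : ∀ {a} → IsSquare (ι (- a)) → IsSquare (-̂ ι a)
  isSquare-ι-neg (s , e) = s , null-cong (λ n → R.refl) e

  module _ (u2 : Unit (1# + 1#)) where
    -- If `x` and `y` have different values, or one of them is zero, the sum has even value. So both
    -- have the same value `m`, oddness gives `n > 2m`, and `(x / y)² + 1` lies in `𝔪`; Hensel's
    -- lemma lifts `x / y` to a root of -1.
    oddTwoSquares⇒isSquare-1 : ∀ {n x y} → Odd n → HasValue n (x * x + y * y) → IsSquare (ι (- 1#))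
    oddTwoSquares⇒isSquare-1 {n} {x} {y} odd vs with zero⊎value x | zero⊎value y
    ... | inj₁ x≈0 | _ = contradiction (value-square⇒even (value-cong
      (R.trans (R.+-congʳ (R.trans (R.*-congʳ x≈0) (R.zeroˡ x))) (R.+-identityˡ _)) vs)) odd
    ... | _ | inj₁ y≈0 = contradiction (value-square⇒even (value-cong
      (R.trans (R.+-congˡ (R.trans (R.*-congʳ y≈0) (R.zeroˡ y))) (R.+-identityʳ _)) vs)) odd
    ... | inj₂ (m , vx) | inj₂ (l , vy) with ℤ.<-cmp m l
    ... | tri< m<l _ _ = contradiction
      (≡.subst Even (value-unique (value-sum-< vx vy m<l) vs) (even-double m)) odd
    ... | tri> _ _ l<m = contradiction
      (≡.subst Even (value-unique (value-cong (R.+-comm _ _) (value-sum-< vy vx l<m)) vs) (even-double l)) odd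
    ... | tri≈ _ ≡.refl _ =
      let z , yz≈1 = inverse vy
          vz = value-inverse vy yz≈1
          2m≤n : m ℤ.+ m ℤ.≤ n
          2m≤n = value-bound vs (bound-+ (value⇒bound (value-* vx vx)) (value⇒bound (value-* vy vy)))
          2m<n : ℤ.suc (m ℤ.+ m) ℤ.≤ n
          2m<n = ℤ.i<j⇒suc[i]≤j (ℤ.≤∧≢⇒< 2m≤n λ { ≡.refl → odd (even-double m) })
      in Hensel.isSquare u2 {x₀ = x * z}
           (≡.trans (value-* vx vz) (≡.cong [_] (ℤ.+-inverseʳ m)))
           (bound-cong (t²+1 z yz≈1)
             (bound-≤ (ℤ.≤-reflexive (1≡ m)) (bound-* (bound-≤ 2m<n (value⇒bound vs)) (value⇒bound (value-* vz vz)))))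
      where
      1≡ : ∀ m → 1ℤ ≡ ℤ.suc (m ℤ.+ m) ℤ.+ (ℤ.- m ℤ.+ ℤ.- m)
      1≡ m = ≡.sym (≡.trans (ℤ.+-assoc 1ℤ (m ℤ.+ m) _) (≡.cong (λ i → 1ℤ ℤ.+ i)
        (≡.trans (≡.cong (λ i → m ℤ.+ m ℤ.+ i) (≡.sym (ℤ.neg-distrib-+ m m))) (ℤ.+-inverseʳ (m ℤ.+ m)))))
      t²+1 : ∀ z → y * z ≈ 1# → (x * x + y * y) * (z * z) ≈ x * z * (x * z) - - 1#
      t²+1 z yz≈1 = begin
        (x * x + y * y) * (z * z)              ≈⟨ solve 3 (λ x y z → (x :* x :+ y :* y) :* (z :* z) :=
          x :* z :* (x :* z) :+ y :* z :* (y :* z)) R.refl x y z ⟩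
        x * z * (x * z) + y * z * (y * z)      ≈⟨ R.+-congˡ (R.*-cong yz≈1 yz≈1) ⟩
        x * z * (x * z) + 1# * 1#              ≈⟨ solve 1 (λ t → t :+ con 1ℤ :* con 1ℤ := t :- (:- con 1ℤ)) R.refl (x * z * (x * z)) ⟩
        x * z * (x * z) - - 1#                 ∎

    odd⇒¬twoSquares : ∀ {n a} → HasValue n a → Odd n → ¬ IsSquare (ι (- 1#)) → ¬ IsSumOfSquares 2 (ι a)
    odd⇒¬twoSquares va odd ¬sq (s , a≈) = ¬sq (oddTwoSquares⇒isSquare-1 odd
      (value-cong (R.+-congˡ (R.+-identityʳ _)) (proj₂ (limit-value va a≈))))

    module _ {p} (base : EuclideanBase p) where
      -- One square stays in `K` and the other is lifted: if `x` is a unit, then `u − y² ≋ x²` has a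
      -- root by Hensel's lemma. Not both `x` and `y` lie in `𝔪`, because `u` is a unit.
      unit-square+K² : ∀ {u} → Unit u → ∃[ b ] ∃[ y ] IsSquare (ι b) × u ≈ b + y * y
      unit-square+K² {u} uu = split (unit-twoSquares base u2 uu)
        where
        lift : ∀ {x y} → Unit x → u ≋ x * x + y * y → ∃[ b ] ∃[ y ] IsSquare (ι b) × u ≈ b + y * y
        lift {x} {y} ux e = u - y * y , y ,
          Hensel.isSquare u2 ux (bound-cong
            (solve 3 (λ u x y → :- (u :- (x :+ y)) := x :- (u :- y)) R.refl u (x * x) (y * y)) (bound-neg e)) ,
          solve 2 (λ u y → u := u :- y :+ y) R.refl u (y * y)
        split : SumOfTwoSquares u → ∃[ b ] ∃[ y ] IsSquare (ι b) × u ≈ b + y * y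
        split (x , y , ox , oy , e) with unit⊎𝔪 ox | unit⊎𝔪 oy
        ... | inj₁ ux | _       = lift ux e
        ... | _       | inj₁ uy = lift uy (≋-trans e (≋-reflexive (R.+-comm _ _)))
        ... | inj₂ mx | inj₂ my = contradiction
          (bound-cong (solve 2 (λ u z → (u :- z) :+ z := u) R.refl u (x * x + y * y))
            (bound-+ e (bound-+ (𝔪-*ˡ ox mx) (𝔪-*ˡ oy my)))) (unit⇒∉𝔪 uu)

      -- With `n = 2m` and `d` of value `m`, dividing `a` by `d²` gives a unit; its two squares are
      -- then multiplied by `d²`.
      even⇒twoSquares : ∀ {n a} → HasValue n a → Even n → IsSumOfSquares 2 (ι a)
      even⇒twoSquares {n} {a} va even with even⇒double n even
      ... | m , ≡.refl =
        let d , vd    = surjective m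
            e , de≈1 = inverse vd
        in finish d e de≈1 (unit-square+K² (unit-e²a vd (value-inverse vd de≈1)))
        where
        unit-e²a : ∀ {d e} → HasValue m d → HasValue (ℤ.- m) e → Unit (e * e * a)
        unit-e²a vd ve = ≡.trans (value-* (value-* ve ve) va) (≡.cong [_]
          (≡.trans (≡.cong (ℤ._+ (m ℤ.+ m)) (≡.sym (ℤ.neg-distrib-+ m m))) (ℤ.+-inverseˡ (m ℤ.+ m))))
        rescale : ∀ d e b y → d * e ≈ 1# → e * e * a ≈ b + y * y → a ≈ d * d * b + d * y * (d * y)
        rescale d e b y de≈1 eq = begin
          a                              ≈⟨ solve 1 (λ a → a := con 1ℤ :* con 1ℤ :* a) R.refl a ⟩
          1# * 1# * a                    ≈⟨ R.*-congʳ (R.*-cong (R.sym de≈1) (R.sym de≈1)) ⟩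
          d * e * (d * e) * a            ≈⟨ solve 3 (λ a d e → d :* e :* (d :* e) :* a := d :* d :* (e :* e :* a)) R.refl a d e ⟩
          d * d * (e * e * a)            ≈⟨ R.*-congˡ eq ⟩
          d * d * (b + y * y)            ≈⟨ solve 3 (λ b d y → d :* d :* (b :+ y :* y) := d :* d :* b :+ d :* y :* (d :* y)) R.refl b d y ⟩
          d * d * b + d * y * (d * y)    ∎

        finish : ∀ d e → d * e ≈ 1# →
                 ∃[ b ] ∃[ y ] IsSquare (ι b) × e * e * a ≈ b + y * y → IsSumOfSquares 2 (ι a)
        finish d e de≈1 (b , y , sq , eq) = twoSquares {b = b} {d} {d * y} sq (rescale d e b y de≈1 eq)

      isSquare-1⇒twoSquares : ∀ {a} → IsSquare (ι (- 1#)) → IsSumOfSquares 2 (ι a)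
      isSquare-1⇒twoSquares {a} sq with inverse u2
      ... | h , 2h≈1 = twoSquares {b = - 1#} sq (R.trans (differenceOfSquares a h 2h≈1) (R.+-comm _ _))

      -- In `a = z² + d² (−1)` the unit -1 is itself a sum of two squares.
      sumOfThreeSquares : ∀ a → IsSumOfSquares 3 (ι a)
      sumOfThreeSquares a = finish (inverse u2) (unit-square+K² v--1)
        where
        finish : ∃[ h ] (1# + 1#) * h ≈ 1# →
                 ∃[ b ] ∃[ y ] IsSquare (ι b) × - 1# ≈ b + y * y → IsSumOfSquares 3 (ι a)
        finish (h , 2h≈1) (b , y , sq , eq) = threeSquares {b = b} {d} {d * y} {z} sq (begin
          a                                        ≈⟨ differenceOfSquares a h 2h≈1 ⟩
          z * z + d * d * - 1#                     ≈⟨ R.+-congˡ (R.*-congˡ eq) ⟩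
          z * z + d * d * (b + y * y)              ≈⟨ solve 4 (λ b d y z →
            z :* z :+ d :* d :* (b :+ y :* y) := d :* d :* b :+ d :* y :* (d :* y) :+ z :* z) R.refl b d y z ⟩
          d * d * b + d * y * (d * y) + z * z      ∎)
          where
          z = (a + 1#) * h
          d = (a - 1#) * h

      lengths : ∀ {a n} → HasValue n a →
        (Odd n → IsSquare (-̂ ι 1#) → HasLength (ι a) [ 2 ]) ×
        (Odd n → ¬ IsSquare (-̂ ι 1#) → HasLength (ι a) [ 3 ]) ×
        (Even n → IsSquare (ι a) → HasLength (ι a) [ 1 ]) ×
        (Even n → ¬ IsSquare (ι a) → HasLength (ι a) [ 2 ])
      lengths {a} {n} va
        = (λ odd sq  → isSquare-1⇒twoSquares (isSquare-neg-ι sq) , below-2 (odd⇒¬isSquare va odd))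
        , (λ odd ¬sq → sumOfThreeSquares a , below-3 odd ¬sq)
        , (λ _ sq    → oneSquare sq , λ { zero _ → ¬zeroSquares va ; (suc _) (ℕ.s≤s ()) })
        , (λ even ¬sq → even⇒twoSquares va even , below-2 ¬sq)
        where
        -- Serves odd values too, since an odd value rules out a square.
        below-2 : ¬ IsSquare (ι a) → ∀ m → m ℕ.< 2 → ¬ IsSumOfSquares m (ι a)
        below-2 ¬sq 0 _ = ¬zeroSquares va
        below-2 ¬sq 1 _ = λ s → ¬sq (oneSquare⇒isSquare s)
        below-2 ¬sq (suc (suc _)) (ℕ.s≤s (ℕ.s≤s ()))
        below-3 : Odd n → ¬ IsSquare (-̂ ι 1#) → ∀ m → m ℕ.< 3 → ¬ IsSumOfSquares m (ι a)
        below-3 odd ¬sq 0 = λ _ → ¬zeroSquares va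
        below-3 odd ¬sq 1 = λ _ s → odd⇒¬isSquare va odd (oneSquare⇒isSquare s)
        below-3 odd ¬sq 2 = λ _ → odd⇒¬twoSquares va odd (λ sq → ¬sq (isSquare-ι-neg sq))
        below-3 odd ¬sq (suc (suc (suc _))) (ℕ.s≤s (ℕ.s≤s (ℕ.s≤s ())))

-- Euclidean bases of global fields.

module Bases {c ℓ₁ ℓ₂ : Level} (K : HeytingField c ℓ₁ ℓ₂) (𝔭 : FinitePlace K) where
  open HeytingField K
  open FinitePlace 𝔭
  open Completion K 𝔭
  open Place K 𝔭
  open Residue K 𝔭
  open TwoSquares K 𝔭
  private module R = CommutativeRing (commutativeRing K)
  open RawMonoidDefinitions R.+-rawMonoid using (sum)
  open IntegerCoefficients (commutativeRing K)
  open Polynomials (commutativeRing K)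
  open Exp R.semiring using (_^_; ^-homo-*)
  open import Relation.Binary.Reasoning.Setoid R.setoid

  sum⇒span : ∀ {p} {k : Carrier → Set p} {n} (a g : Vector Carrier n) → (∀ i → k (a i)) →
             ∀ {x} → x ≈ sum (λ i → a i * g i) → Span k g x
  sum⇒span {n = zero}  a g ka e = nil e
  sum⇒span {n = suc n} a g ka e = cons (ka Fin.zero) (sum⇒span (tail a) (tail g) (λ i → ka (Fin.suc i)) R.refl) e

  Image : ∀ {a r s} (L : HeytingField a r s) → (HeytingField.Carrier L → Carrier) → Carrier → Set (a ⊔ ℓ₁)
  Image L f x = ∃[ l ] x ≈ f l

  IsHom : ∀ {a r s} (L : HeytingField a r s) → (HeytingField.Carrier L → Carrier) → Set _
  IsHom L = IsRingHomomorphism (CommutativeRing.rawRing (commutativeRing L)) R.rawRing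

  module _ {a r s} (L : HeytingField a r s) {f : HeytingField.Carrier L → Carrier} (isHom : IsHom L f) where
    open IsRingHomomorphism isHom
    private module L = HeytingField L

    image-isSubring : IsSubring (Image L f)
    image-isSubring = record
      { resp  = λ { x≈y (l , e) → l , R.trans (R.sym x≈y) e }
      ; ∈-1   = L.1# , R.sym 1#-homo
      ; ∈-+   = λ { (l , e) (m , e′) → l L.+ m , R.trans (R.+-cong e e′) (R.sym (+-homo l m)) }
      ; ∈-*   = λ { (l , e) (m , e′) → l L.* m , R.trans (R.*-cong e e′) (R.sym (*-homo l m)) }
      ; ∈-neg = λ { (l , e) → L.- l , R.trans (R.-‿cong e) (R.sym (-‿homo l)) }
      }

    #0⇒value : ∀ {l} → l L.# L.0# → ∃[ n ] HasValue n (f l)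
    #0⇒value {l} l#0 with L.#⇒invertible l#0
    ... | m , _ , [l-0]m≈1 = invertible⇒value (R.trans (R.sym (*-homo l m)) (R.trans (⟦⟧-cong
      (L.trans (L.*-congʳ (L.sym (HeytingRingProperties.x-0≈x L.heytingCommutativeRing l))) [l-0]m≈1)) 1#-homo))

    ≉0⇒≉0 : ∀ {l} → ¬ l L.≈ L.0# → ¬ f l ≈ 0#
    ≉0⇒≉0 {l} l≉0 fl≈0 = l≉0 (proj₁ (L.tight l L.0#) λ l#0 → value⇒≉0 (proj₂ (#0⇒value l#0)) fl≈0)

  -- Number fields, over the integers.

  module NumberField (ext : FiniteExtension ℚ-field K) where
    open FiniteExtension ext
    open IsRingHomomorphism isHom

    fromℤℚ : ℤ → ℚ
    fromℤℚ z = mkℚ z 0 (Coprime.sym (Coprime.1-coprimeTo ℤ.∣ z ∣))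

    fromℤℚ-+ : ∀ x y → fromℤℚ (x ℤ.+ y) ≡ fromℤℚ x ℚ.+ fromℤℚ y
    fromℤℚ-+ x y = ℚ.toℚᵘ-injective (ℚᵘ.≃-trans
      (ℚᵘ.*≡* (≡.cong (ℤ._* 1ℤ) (≡.sym (≡.cong₂ ℤ._+_ (ℤ.*-identityʳ x) (ℤ.*-identityʳ y)))))
      (ℚᵘ.≃-sym (ℚ.toℚᵘ-homo-+ (fromℤℚ x) (fromℤℚ y))))

    fromℤℚ-* : ∀ x y → fromℤℚ (x ℤ.* y) ≡ fromℤℚ x ℚ.* fromℤℚ y
    fromℤℚ-* x y = ℚ.toℚᵘ-injective (ℚᵘ.≃-trans (ℚᵘ.*≡* ≡.refl)
      (ℚᵘ.≃-sym (ℚ.toℚᵘ-homo-* (fromℤℚ x) (fromℤℚ y))))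

    fromℤℚ-neg : ∀ x → fromℤℚ (ℤ.- x) ≡ ℚ.- fromℤℚ x
    fromℤℚ-neg x = ℚ.toℚᵘ-injective (ℚᵘ.≃-trans (ℚᵘ.*≡* ≡.refl) (ℚᵘ.≃-sym (ℚ.toℚᵘ-homo‿- (fromℤℚ x))))

    clearDenominator : ∀ q → q ℚ.* fromℤℚ (ℚ.↧ q) ≡ fromℤℚ (ℚ.↥ q)
    clearDenominator q@(mkℚ n d _) = ℚ.toℚᵘ-injective (ℚᵘ.≃-trans (ℚ.toℚᵘ-homo-* q (fromℤℚ (ℚ.↧ q)))
      (ℚᵘ.*≡* (ℤ.*-assoc n (+ suc d) 1ℤ)))

    ⟪_⟫ : ℤ → Carrier
    ⟪ z ⟫ = ⟦ fromℤℚ z ⟧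

    ⟪⟫-+ : ∀ x y → ⟪ x ℤ.+ y ⟫ ≈ ⟪ x ⟫ + ⟪ y ⟫
    ⟪⟫-+ x y = R.trans (⟦⟧-cong (fromℤℚ-+ x y)) (+-homo _ _)

    ⟪⟫-* : ∀ x y → ⟪ x ℤ.* y ⟫ ≈ ⟪ x ⟫ * ⟪ y ⟫
    ⟪⟫-* x y = R.trans (⟦⟧-cong (fromℤℚ-* x y)) (*-homo _ _)

    ⟪⟫-neg : ∀ x → ⟪ ℤ.- x ⟫ ≈ - ⟪ x ⟫
    ⟪⟫-neg x = R.trans (⟦⟧-cong (fromℤℚ-neg x)) (-‿homo _)

    ⟪⟫-0 : ⟪ 0ℤ ⟫ ≈ 0#
    ⟪⟫-0 = R.trans (⟦⟧-cong (ℚ.toℚᵘ-injective (ℚᵘ.*≡* ≡.refl))) 0#-homo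

    ⟪⟫-1 : ⟪ 1ℤ ⟫ ≈ 1#
    ⟪⟫-1 = R.trans (⟦⟧-cong (ℚ.toℚᵘ-injective (ℚᵘ.*≡* ≡.refl))) 1#-homo

    𝒪-ℕ : ∀ n → 𝒪 ⟪ + n ⟫
    𝒪-ℕ zero    = bound-0 ⟪⟫-0
    𝒪-ℕ (suc n) = bound-cong (R.sym (⟪⟫-+ 1ℤ (+ n)))
      (bound-+ (bound-cong (R.sym ⟪⟫-1) 𝒪-1) (𝒪-ℕ n))

    𝒪-ℤ : ∀ z → 𝒪 ⟪ z ⟫
    𝒪-ℤ (+ n)    = 𝒪-ℕ n
    𝒪-ℤ -[1+ n ] = bound-cong (R.sym (⟪⟫-neg (+ suc n))) (bound-neg (𝒪-ℕ (suc n)))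

    Size : ℕ → Carrier → Set ℓ₁
    Size n x = ∃[ z ] ℤ.∣ z ∣ ℕ.≤ n × x ≈ ⟪ z ⟫

    covered : ∀ n → Covered (Size n)
    -- Both signs at once: an integer is `x + (−1) y` with naturals `x` and `y`, one of them 0.
    covered n = covered-⊆ decompose (covered-affine (bound-neg 𝒪-1) naturals naturals)
      where
      Natural : Carrier → Set ℓ₁
      Natural x = ∃[ m ] m ℕ.≤ n × x ≈ ⟪ + m ⟫
      naturals : Covered Natural
      naturals = suc n , (λ i → ⟪ + Fin.toℕ i ⟫) , λ { x (m , m≤n , e) → Fin.fromℕ< (ℕ.s≤s m≤n) ,
        ≋-reflexive (R.trans e (R.reflexive (≡.cong (λ k → ⟪ + k ⟫) (≡.sym (Fin.toℕ-fromℕ< (ℕ.s≤s m≤n)))))) }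
      decompose : ∀ {x} → Size n x →
        ∃[ z ] (∃[ x′ ] ∃[ y′ ] Natural x′ × Natural y′ × z ≈ x′ + - 1# * y′) × x ≋ z
      decompose {x} (+ m , le , e) = x , (_ , _ , (m , le , R.refl) , (0 , ℕ.z≤n , R.refl) ,
        R.trans e (R.trans (solve 1 (λ y → y := y :+ (:- con 1ℤ) :* con 0ℤ) R.refl _)
          (R.+-congˡ (R.*-congˡ (R.sym ⟪⟫-0))))) , ≋-refl
      decompose {x} (-[1+ m ] , le , e) = x , (_ , _ , (0 , ℕ.z≤n , R.refl) , (suc m , le , R.refl) ,
        R.trans e (R.trans (⟪⟫-neg (+ suc m)) (R.trans (solve 1 (λ y → :- y := con 0ℤ :+ (:- con 1ℤ) :* y) R.refl _)
          (R.+-congʳ (R.sym ⟪⟫-0))))) , ≋-refl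

    divide : ∀ {m n a b} → Size m a → Size (suc n) b → b ≈ 0# ⊎
      (∃[ q ] ∃[ r ] (∃[ l ] Size l q) × Size n r × a ≈ q * b + r)
    divide {n = n} {a} {b} (x , _ , e) (y , le , e′) with y ℤ.≟ 0ℤ
    ... | yes ≡.refl = inj₁ (R.trans e′ ⟪⟫-0)
    ... | no y≢0 = inj₂ (⟪ x ℤ./ y ⟫ , ⟪ + (x ℤ.% y) ⟫ , (_ , _ , ℕ.≤-refl , R.refl) ,
        (_ , ℕ.≤-pred (ℕ.<-≤-trans (ℤ.n%d<d x y) le) , R.refl) , (begin
      a                                                 ≈⟨ e ⟩
      ⟪ x ⟫                                             ≡⟨ ≡.cong ⟪_⟫ (ℤ.a≡a%n+[a/n]*n x y) ⟩
      ⟪ + (x ℤ.% y) ℤ.+ (x ℤ./ y) ℤ.* y ⟫               ≈⟨ R.trans (⟪⟫-+ _ _) (R.+-comm _ _) ⟩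
      ⟪ (x ℤ./ y) ℤ.* y ⟫ + ⟪ + (x ℤ.% y) ⟫             ≈⟨ R.+-congʳ (R.trans (⟪⟫-* _ _) (R.*-congˡ (R.sym e′))) ⟩
      ⟪ x ℤ./ y ⟫ * b + ⟪ + (x ℤ.% y) ⟫                 ∎))
      where instance _ = ℤ.≢-nonZero y≢0

    isSubring : IsSubring (λ x → ∃[ n ] Size n x)
    isSubring = record
      { resp  = λ { x≈y (n , z , le , e) → n , z , le , R.trans (R.sym x≈y) e }
      ; ∈-1   = _ , 1ℤ , ℕ.≤-refl , R.sym ⟪⟫-1
      ; ∈-+   = λ { (_ , x , _ , e) (_ , y , _ , e′) → _ , x ℤ.+ y , ℕ.≤-refl , R.trans (R.+-cong e e′) (R.sym (⟪⟫-+ x y)) }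
      ; ∈-*   = λ { (_ , x , _ , e) (_ , y , _ , e′) → _ , x ℤ.* y , ℕ.≤-refl , R.trans (R.*-cong e e′) (R.sym (⟪⟫-* x y)) }
      ; ∈-neg = λ { (_ , x , _ , e) → _ , ℤ.- x , ℕ.≤-refl , R.trans (R.-‿cong e) (R.sym (⟪⟫-neg x)) }
      }

    rational-fraction : ∀ q → Fraction (λ x → ∃[ n ] Size n x) ⟦ q ⟧
    rational-fraction q = ⟪ ℚ.↥ q ⟫ , ⟪ ℚ.↧ q ⟫ , _ ,
      (_ , _ , ℕ.≤-refl , R.refl) , (_ , _ , ℕ.≤-refl , R.refl) ,
      proj₂ (#0⇒value ℚ-field isHom (denominator≢0 q)) ,
      R.trans (R.sym (*-homo q _)) (⟦⟧-cong (clearDenominator q))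
      where
      denominator≢0 : ∀ q → ¬ fromℤℚ (ℚ.↧ q) ≡ ℚ.0ℚ
      denominator≢0 (mkℚ _ _ _) ()

    base : EuclideanBase ℓ₁
    base = record
      { Size      = Size
      ; isSubring = isSubring
      ; integral  = λ { (z , _ , e) → bound-cong (R.sym e) (𝒪-ℤ z) }
      ; size-0    = λ { (z , le , e) → R.trans e (R.trans
          (R.reflexive (≡.cong ⟪_⟫ (ℤ.∣i∣≡0⇒i≡0 (ℕ.n≤0⇒n≡0 le)))) ⟪⟫-0) }
      ; divide    = divide
      ; covered   = covered
      ; degree    = size
      ; basis     = generators
      ; spanning  = λ x → let a , e = spanning x in
          sum⇒span (λ i → ⟦ a i ⟧) generators (λ i → rational-fraction (a i)) e
      }

  -- Function fields, over polynomials with finitely many constants.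

  module FunctionField {F E : HeytingField c ℓ₁ ℓ₂} (finite : IsFinite F) (char≢2 : Char≢2 F)
                       (rational : IsRationalFunctionField F E) (ext : FiniteExtension E K) where
    private
      module F = HeytingField F
      module E = HeytingField E
      module Rat = IsRationalFunctionField rational
      module Ext = FiniteExtension ext
      module φ = IsRingHomomorphism Ext.isHom

    constant : F.Carrier → Carrier
    constant f = Ext.⟦ Rat.⟦ f ⟧ ⟧

    constant-isHom : IsHom F constant
    constant-isHom = Composition.isRingHomomorphism R.trans Rat.isHom Ext.isHom

    Constant : Carrier → Set (c ⊔ ℓ₁)
    Constant = Image F constant

    constant-isSubring : IsSubring Constant
    constant-isSubring = image-isSubring F constant-isHom
    private module C = IsSubring constant-isSubring

    constant-finite : FiniteUpTo _≈_ Constant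
    constant-finite = n , (λ i → constant (from i)) , λ { x (f , e) → to f ,
      R.trans e (φ.⟦⟧-cong (IsRingHomomorphism.⟦⟧-cong Rat.isHom (F.sym (strictlyInverseʳ f)))) }
      where
      n = proj₁ finite
      open Inverse (proj₂ finite)

    value-^ : ∀ {n x} → HasValue n x → ∀ k → HasValue (+ k ℤ.* n) (x ^ k)
    value-^ {n} vx zero    = ≡.trans v-1 (≡.cong [_] (≡.sym (ℤ.*-zeroˡ n)))
    value-^ {n} vx (suc k) = ≡.trans (value-* vx (value-^ vx k)) (≡.cong [_] (≡.sym (ℤ.suc-* (+ k) n)))

    -- The powers of a constant repeat, here as exact equalities. Hence a nonzero constant has value
    -- 0 at every place, and a power of it is its inverse.
    constant-torsion : ∀ {n x} → Constant x → HasValue n x → ∃[ N ] x ^ suc N ≈ 1#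
    constant-torsion {x = x} cx vx =
      cancel (pigeonhole (λ x≈z y≈z → R.trans x≈z (R.sym y≈z)) constant-finite (x ^_) (C.∈-^ cx))
      where
      cancel : ∃[ i ] ∃[ N ] x ^ i ≈ x ^ (suc N ℕ.+ i) → ∃[ N ] x ^ suc N ≈ 1#
      cancel (i , N , e) = N , *-cancelˡ (value-^ vx i) (R.trans (R.*-comm _ _)
        (R.trans (R.sym (^-homo-* x (suc N) i)) (R.trans (R.sym e) (R.sym (R.*-identityʳ (x ^ i))))))

    constant-value : ∀ {n x} → Constant x → HasValue n x → n ≡ 0ℤ
    constant-value {n} {x} cx vx = trivial (constant-torsion cx vx)
      where
      trivial : ∃[ N ] x ^ suc N ≈ 1# → n ≡ 0ℤ
      trivial (N , e) with ℤ.i*j≡0⇒i≡0∨j≡0 (+ suc N) (value-unique (value-^ vx (suc N)) (value-cong (R.sym e) v-1))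
      ... | inj₂ n≡0 = n≡0

    constant⊆𝒪 : ∀ {x} → Constant x → 𝒪 x
    constant⊆𝒪 {x} cx with zero⊎value x
    ... | inj₁ x≈0 = bound-0 x≈0
    ... | inj₂ (n , vx) = value⇒bound (≡.trans vx (≡.cong [_] (constant-value cx vx)))

    constant-isSubfield : IsSubfield Constant
    constant-isSubfield = record
      { isSubring = constant-isSubring
      ; ∈-inverse = λ {n} {x} cx vx → let N , e = constant-torsion cx vx in x ^ N , C.∈-^ cx N , e
      }

    constant-covered : Covered Constant
    constant-covered = let n , r , cover = constant-finite in
      n , r , λ x cx → let i , e = cover x cx in i , ≋-reflexive e

    -- The element 2 is a constant, and it is nonzero because `F` embeds in `K`.
    unit-2 : Unit (1# + 1#)
    unit-2 with zero⊎value (1# + 1#)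
    ... | inj₂ (n , v2) = ≡.trans v2 (≡.cong [_] (constant-value (C.∈-+ C.∈-1 C.∈-1) v2))
    ... | inj₁ 2≈0 = contradiction (R.trans (R.trans (+-homo F.1# F.1#) (R.+-cong 1#-homo 1#-homo)) 2≈0)
                                   (≉0⇒≉0 F constant-isHom char≢2)
      where open IsRingHomomorphism constant-isHom

    variable∈A : ∀ y → ∃[ n ] Poly Constant y n y
    variable∈A y = 2 , poly-resp constant-isSubring y (R.*-identityʳ y)
      (poly-shift constant-isSubring y (poly-const constant-isSubring y C.∈-1))

    module _ {y : Carrier} (oy : 𝒪 y) where
      Size : ℕ → Carrier → Set (c ⊔ ℓ₁)
      Size = Poly Constant y

      A : Carrier → Set (c ⊔ ℓ₁)
      A x = ∃[ n ] Size n x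

      A-isSubring : IsSubring A
      A-isSubring = poly-isSubring constant-isSubring y

      -- `Size` counts coefficients, so a nonzero divisor in `Size (suc n)` is made monic of degree
      -- `d ≤ n` by a constant `e`, and the remainder has `d` coefficients. The factor `e` moves
      -- into the quotient.
      divide : ∀ {m n a b} → Size m a → Size (suc n) b → b ≈ 0# ⊎
        (∃[ q ] ∃[ r ] (∃[ l ] Size l q) × Size n r × a ≈ q * b + r)
      divide {b = b} P Q with zero⊎monic constant-isSubfield Q
      ... | inj₁ b≈0 = inj₁ b≈0
      ... | inj₂ (d , _ , e , ℕ.s≤s d≤n , ∈e , _ , M) =
        let q , r , P′ , P″ , eq = division constant-isSubring y M P
        in inj₂ (e * q , r , (_ , poly-scale constant-isSubring y ∈e P′) , poly-≤ constant-isSubring y d≤n P″ ,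
             R.trans eq (R.+-congʳ (solve 3 (λ q e b → q :* (e :* b) := e :* q :* b) R.refl q e b)))

      module _ (X∈k : Fraction A Ext.⟦ Rat.X ⟧) where
        private module k = IsSubfield (fraction-isSubfield A-isSubring)

        polynomial∈k : ∀ p → Fraction A Ext.⟦ Rat.⟨ p ⟩ ⟧
        polynomial∈k List.[]      = k.resp (R.sym φ.0#-homo) k.∈-0
        polynomial∈k (f List.∷ p) = k.resp (R.sym (R.trans (φ.+-homo _ _) (R.+-congˡ (φ.*-homo _ _))))
          (k.∈-+ (⊆fraction A-isSubring (1 , poly-const constant-isSubring y (f , R.refl)))
                 (k.∈-* X∈k (polynomial∈k p)))

        rational∈k : ∀ e → Fraction A Ext.⟦ e ⟧
        rational∈k e =
          let p , q , q#0 , eq≈p = Rat.fraction e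
          in divide-in-k (polynomial∈k p) (k.∈-inverse (polynomial∈k q) (proj₂ (#0⇒value E Ext.isHom q#0)))
               (R.trans (R.sym (φ.*-homo e _)) (φ.⟦⟧-cong eq≈p))
          where
          divide-in-k : ∀ {x q p} → Fraction A p → ∃[ w ] Fraction A w × q * w ≈ 1# → x * q ≈ p → Fraction A x
          divide-in-k {x} {q} ∈p (w , ∈w , qw≈1) xq≈p = k.resp
            (R.trans (R.*-congʳ (R.sym xq≈p))
              (R.trans (R.*-assoc x q w) (R.trans (R.*-congˡ qw≈1) (R.*-identityʳ x))))
            (k.∈-* ∈p ∈w)

        polynomialBase : EuclideanBase (c ⊔ ℓ₁)
        polynomialBase = record
          { Size      = Size
          ; isSubring = A-isSubring
          ; integral  = poly⊆ 𝒪-isSubring constant⊆𝒪 oy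
          ; size-0    = λ { (nil x≈0) → x≈0 }
          ; divide    = divide
          ; covered   = covered-poly oy constant-covered
          ; degree    = Ext.size
          ; basis     = Ext.generators
          ; spanning  = λ x → let a , e = Ext.spanning x in
              sum⇒span (λ i → Ext.⟦ a i ⟧) Ext.generators (λ i → rational∈k (a i)) e
          }

    𝒪⊎inverse : ∀ x → 𝒪 x ⊎ (∃[ y ] ∃[ n ] 𝒪 y × HasValue n y × x * y ≈ 1#)
    𝒪⊎inverse x with v x in eq
    ... | ⊤⁺           = inj₁ (_ ≤⊤⁺)
    ... | [ + n ]      = inj₁ [ ℤ.+≤+ ℕ.z≤n ]
    ... | [ -[1+ n ] ] =
      let y , xy≈1 = inverse eq
          vy = value-inverse eq xy≈1
      in inj₂ (y , + suc n , bound-≤ (ℤ.+≤+ ℕ.z≤n) (value⇒bound vy) , vy , xy≈1)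

    -- At a place with v(X) < 0 the polynomials in 1/X are integral instead of those in X.
    base : EuclideanBase (c ⊔ ℓ₁)
    base with 𝒪⊎inverse Ext.⟦ Rat.X ⟧
    ... | inj₁ oX = polynomialBase oX (⊆fraction (A-isSubring oX) (variable∈A _))
    ... | inj₂ (y , n , oy , vy , Xy≈1) = polynomialBase oy
      (1# , y , n , IsSubring.∈-1 (A-isSubring oy) , variable∈A y , vy , Xy≈1)

mainTheorem1 : {c ℓ₁ ℓ₂ : Level} (K : HeytingField c ℓ₁ ℓ₂) (G : IsGlobalField≢2 K) →
    (𝔭 : FinitePlace K) → NonDyadic G 𝔭 →
    let open HeytingField K
        open FinitePlace 𝔭
        open Completion K 𝔭
        open SumsOfSquares completion in
    (a : Carrier) → a # 0# → (n : ℤ) → v a ≡ [ n ] →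
    (Odd n → IsSquare (-̂ ι 1#) → HasLength (ι a) [ 2 ]) ×
    (Odd n → ¬ IsSquare (-̂ ι 1#) → HasLength (ι a) [ 3 ]) ×
    (Even n → IsSquare (ι a) → HasLength (ι a) [ 1 ]) ×
    (Even n → ¬ IsSquare (ι a) → HasLength (ι a) [ 2 ])
mainTheorem1 K (numberField ext) 𝔭 nonDyadic a _ n va =
  Lengths.lengths K 𝔭 (unit-2 (unit⊎𝔪 (bound-+ 𝒪-1 𝒪-1))) (Bases.NumberField.base K 𝔭 ext) va
  where
  open HeytingField K using (_+_; 1#)
  open Completion K 𝔭 using (bound-+)
  open Place K 𝔭
  unit-2 : Unit (1# + 1#) ⊎ 𝔪 (1# + 1#) → Unit (1# + 1#)
  unit-2 (inj₁ u2) = u2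
  -- By definition `Dyadic` is the statement that 2 lies in `𝔪`.
  unit-2 (inj₂ 𝔪2) = contradiction 𝔪2 nonDyadic
mainTheorem1 K (functionField F E finite char≢2 rational ext) 𝔭 _ a _ n va =
  Lengths.lengths K 𝔭 unit-2 base va
  where open Bases.FunctionField K 𝔭 finite char≢2 rational ext
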